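{- Suppose that $\ell$ is an odd prime, let $t\ge2$ be an integer and let $m=(\ell-1)/2$. Then $$\mathrm{Prob}_\ell(X_t;\mu>0)\le\sum_{i=1}^{\lfloor t/\ell\rfloor}2^{i\ell}\binom{t}{i\ell}\sum_{a_1+\cdots+a_m=i}\frac{(i\ell)!}{(\ell^t-1)\prod_{j=1}^m(a_j\ell)!},$$ where the second sum runs over all tuples $(a_1,\dots,a_m)$ of non-negative integers with $a_1+\cdots+a_m=i$.
   Context: For $b\in\mathbb{Z}_\ell$ put $\binom{b}{n}=\frac{b(b-1)\cdots(b-n+1)}{n!}\in\mathbb{Z}_\ell$ and $(1+T)^b=\sum_{n\ge0}\binom{b}{n}T^n\in\mathbb{Z}_\ell[[T]]$. The bouquet $X_t$ is the multigraph with one vertex and $t$ undirected loops; a vector $\alpha=(\alpha_1,\dots,\alpha_t)\in\mathbb{Z}_\ell^t$ assigns the voltage $\alpha_j$ to the $j$-th loop. It is admissible if $\alpha\in\mathbb{Z}_\ell^t\setminus(\ell\mathbb{Z}_\ell)^t$. The characteristic series is $$f(T)=f_{X_t,\alpha}(T)=\sum_{j=1}^t\big(2-(1+T)^{\alpha_j}-(1+T)^{ -\alpha_j}\big)\in\mathbb{Z}_\ell[[T]].$$ For admissible $\alpha$ it is nonzero, and it has zero constant term. By Weierstrass preparation write $f(T)=\ell^{\mu}g(T)u(T)$ with $\mu\in\mathbb{Z}_{\ge0}$, $g$ a distinguished polynomial (monic, all non-leading coefficients divisible by $\ell$) and $u\in\mathbb{Z}_\ell[[T]]^\times$. Then $\mu_\ell(X_t,\alpha):=\mu$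 and $\lambda_\ell(X_t,\alpha):=\deg g-1$. Let $\tau$ be the Haar measure on $\mathbb{Z}_\ell^t$ normalized by $\tau(\mathbb{Z}_\ell^t)=1$, so $\tau(\mathbb{Z}_\ell^t\setminus(\ell\mathbb{Z}_\ell)^t)=1-\ell^{ -t}$. Define $$\mathrm{Prob}_\ell(X_t;\mu>0)=(1-\ell^{ -t})^{ -1}\,\tau\big(\{\alpha\in\mathbb{Z}_\ell^t\setminus(\ell\mathbb{Z}_\ell)^t:\mu_\ell(X_t,\alpha)>0\}\big).$$ -}

module Defs where

open import Algebra.Bundles using (RawRing; CommutativeRing)
import Algebra.Definitions.RawSemiring as RawSemiringDefinitions
open import Data.Fin.Base using (toℕ)
open import Data.Integer.Base as ℤ using (ℤ; +_; -[1+_]; 0ℤ; 1ℤ)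
open import Data.Integer.Divisibility.Signed
import Data.Integer.Properties as ℤ
open import Data.Integer.Tactic.RingSolver using (solve-∀)
open import Data.List.Base as List using (List; []; _∷_; concatMap; upTo)
import Data.List.Relation.Unary.All as All
import Data.List.Relation.Unary.All.Properties as All
open import Data.Maybe.Base using (Maybe; maybe′)
import Data.Maybe.Relation.Unary.Any as Maybe
open import Data.Nat.Base as ℕ using (ℕ; zero; suc; NonZero; _^_; _∸_; _!)
import Data.Nat.Divisibility as ℕ
open import Data.Nat.ListAction using (product)
open import Data.Nat.ListAction.Properties using (product≢0)
open import Data.Nat.Primality
  using (Prime; prime⇒nonZero; prime⇒nonTrivial; euclidsLemma)
import Data.Nat.Properties as ℕ
open import Data.Product.Base using (∃-syntax; Σ-syntax; _×_; _,_)
open import Data.Rational.Base as ℚ using (ℚ; 0ℚ; 1ℚ; Positive)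
import Data.Rational.Properties as ℚ
import Data.Rational.Unnormalised.Base as ℚᵘ
import Data.Rational.Unnormalised.Properties as ℚᵘ
open import Data.Sum.Base using (inj₁; inj₂)
open import Data.Vec.Base as Vec using (Vec; []; _∷_)
open import Data.Vec.Functional using (Vector)
open import Level using (0ℓ; _⊔_)
open import Relation.Binary.PropositionalEquality
open import Relation.Nullary using (¬_; yes; no; contradiction)
open import Relation.Unary using (Pred; _∈_)

------------------------------------------------------------------------
-- Power series over a ring

module PowerSeries {c e} (R : RawRing c e) where

  private
    module R = RawRing R
    module RD = RawSemiringDefinitions R.rawSemiring

  Series : Set c
  Series = ℕ → R.Carrier

  const : R.Carrier → Series
  const a zero    = a
  const a (suc _) = R.0#

  seriesRawRing : RawRing c e
  seriesRawRing = record
    { Carrier = Series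
    ; _≈_     = λ f g → ∀ n → f n R.≈ g n
    ; _+_     = λ f g n → f n R.+ g n
    ; _*_     = λ f g n → RD.sum {suc n} (λ i → f (toℕ i) R.* g (n ∸ toℕ i))
    ; -_      = λ f n → R.- f n
    ; 0#      = const R.0#
    ; 1#      = const R.1#
    }

  private
    module S = RawRing seriesRawRing
    module SD = RawSemiringDefinitions S.rawSemiring

  IsUnit : Series → Set (c ⊔ e)
  IsUnit u = u SD.∣ S.1#

  -- g is a monic polynomial of degree d whose other coefficients are
  -- divisible by the ring element π.
  record IsDistinguished (π : R.Carrier) (d : ℕ) (g : Series) : Set (c ⊔ e) where
    field
      leading : g d R.≈ R.1#
      above   : ∀ n → d ℕ.< n → g n R.≈ R.0#
      below   : ∀ n → n ℕ.< d → π RD.∣ g n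

  record WeierstrassFactorization (π : R.Carrier) (f : Series) : Set (c ⊔ e) where
    field
      μ             : ℕ
      degree        : ℕ
      g u           : Series
      distinguished : IsDistinguished π degree g
      unit          : IsUnit u
      factorization : f S.≈ (const π SD.^ μ) S.* g S.* u

------------------------------------------------------------------------
-- Binomial coefficients of integers

-- b (b - 1) ⋯ (b - n + 1)
falling : ℤ → ℕ → ℤ
falling b zero    = 1ℤ
falling b (suc n) = falling b n ℤ.* (b ℤ.- + n)

private
  falling-suc : ∀ b n → falling (b ℤ.+ 1ℤ) (suc n) ≡ (b ℤ.+ 1ℤ) ℤ.* falling b n
  falling-suc b zero = lem b where
    lem : ∀ b → 1ℤ ℤ.* ((b ℤ.+ 1ℤ) ℤ.- 0ℤ) ≡ (b ℤ.+ 1ℤ) ℤ.* 1ℤ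
    lem = solve-∀
  falling-suc b (suc n) =
    trans (cong₂ (λ x y → x ℤ.* ((b ℤ.+ 1ℤ) ℤ.- y)) (falling-suc b n) (ℤ.pos-+ 1 n))
          (lem b (falling b n) (+ n))
    where
    lem : ∀ b F n → ((b ℤ.+ 1ℤ) ℤ.* F) ℤ.* ((b ℤ.+ 1ℤ) ℤ.- (1ℤ ℤ.+ n))
                  ≡ (b ℤ.+ 1ℤ) ℤ.* (F ℤ.* (b ℤ.- n))
    lem = solve-∀

  falling-pascal : ∀ b n → falling (b ℤ.+ 1ℤ) (suc n)
                         ≡ falling b (suc n) ℤ.+ (+ suc n) ℤ.* falling b n
  falling-pascal b n = trans (falling-suc b n)
    (trans (lem b (falling b n) (+ n))
           (cong (λ x → falling b (suc n) ℤ.+ x ℤ.* falling b n) (sym (ℤ.pos-+ 1 n))))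
    where
    lem : ∀ b F n → (b ℤ.+ 1ℤ) ℤ.* F ≡ F ℤ.* (b ℤ.- n) ℤ.+ (1ℤ ℤ.+ n) ℤ.* F
    lem = solve-∀

  falling-zero : ∀ n → falling 0ℤ (suc n) ≡ 0ℤ
  falling-zero zero    = refl
  falling-zero (suc n) = cong (ℤ._* (0ℤ ℤ.- + suc n)) (falling-zero n)

!∣falling : ∀ b n → + (n !) ∣ falling b n
!∣falling b zero    = ∣-refl
!∣falling b (suc n) = go b
  where
  step : ∀ b → + (suc n !) ∣ (+ suc n) ℤ.* falling b n
  step b = subst (_∣ + suc n ℤ.* falling b n) (sym (ℤ.pos-* (suc n) (n !)))
             (*-monoʳ-∣ (+ suc n) (!∣falling b n))

  up : ∀ b → + (suc n !) ∣ falling b (suc n) → + (suc n !) ∣ falling (b ℤ.+ 1ℤ) (suc n)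
  up b h = subst (_ ∣_) (sym (falling-pascal b n)) (∣m∣n⇒∣m+n h (step b))

  down : ∀ b → + (suc n !) ∣ falling (b ℤ.+ 1ℤ) (suc n) → + (suc n !) ∣ falling b (suc n)
  down b h = ∣m+n∣n⇒∣m (subst (_ ∣_) (falling-pascal b n) h) (step b)

  base : + (suc n !) ∣ falling 0ℤ (suc n)
  base = subst (+ (suc n !) ∣_) (sym (falling-zero n)) (divides 0ℤ refl)

  go : ∀ b → + (suc n !) ∣ falling b (suc n)
  go (+ zero)      = base
  go (+ suc m)     = subst (λ x → + (suc n !) ∣ falling x (suc n))
                       (cong +_ (ℕ.+-comm m 1)) (up (+ m) (go (+ m)))
  go -[1+ zero ]   = down -[1+ zero ] base
  go -[1+ suc m ]  = down -[1+ suc m ] (go -[1+ m ])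

-- b (b - 1) ⋯ (b - n + 1) / n!
binomialℤ : ℤ → ℕ → ℤ
binomialℤ b n = quotient (!∣falling b n)

------------------------------------------------------------------------
-- The ring of ℓ-adic integers, as the inverse limit of the rings ℤ/ℓⁿ

module ℓ-adic (ℓ : ℕ) (ℓ-prime : Prime ℓ) where

  private instance
    ℓ≢0 : NonZero ℓ
    ℓ≢0 = prime⇒nonZero ℓ-prime

  infix 4 _≡_[modℓ^_]

  record _≡_[modℓ^_] (i j : ℤ) (n : ℕ) : Set where
    constructor congruent
    field divides-difference : + (ℓ ^ n) ∣ i ℤ.- j
  open _≡_[modℓ^_] public

  mod-refl : ∀ {i j} n → i ≡ j → i ≡ j [modℓ^ n ]
  mod-refl {i} n refl = congruent (divides 0ℤ (ℤ.+-inverseʳ i))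

  mod-sym : ∀ {i j n} → i ≡ j [modℓ^ n ] → j ≡ i [modℓ^ n ]
  mod-sym {i} {j} (congruent h) = congruent (subst (_ ∣_) (lem i j) (∣m⇒∣-m h)) where
    lem : ∀ i j → ℤ.- (i ℤ.- j) ≡ j ℤ.- i
    lem = solve-∀

  mod-trans : ∀ {i j k n} → i ≡ j [modℓ^ n ] → j ≡ k [modℓ^ n ] → i ≡ k [modℓ^ n ]
  mod-trans {i} {j} {k} (congruent h) (congruent h′) = congruent (subst (_ ∣_) (lem i j k) (∣m∣n⇒∣m+n h h′)) where
    lem : ∀ i j k → (i ℤ.- j) ℤ.+ (j ℤ.- k) ≡ i ℤ.- k
    lem = solve-∀

  mod-+ : ∀ {i j k l n} → i ≡ j [modℓ^ n ] → k ≡ l [modℓ^ n ] →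
          i ℤ.+ k ≡ j ℤ.+ l [modℓ^ n ]
  mod-+ {i} {j} {k} {l} (congruent h) (congruent h′) = congruent (subst (_ ∣_) (lem i j k l) (∣m∣n⇒∣m+n h h′)) where
    lem : ∀ i j k l → (i ℤ.- j) ℤ.+ (k ℤ.- l) ≡ (i ℤ.+ k) ℤ.- (j ℤ.+ l)
    lem = solve-∀

  mod-neg : ∀ {i j n} → i ≡ j [modℓ^ n ] → ℤ.- i ≡ ℤ.- j [modℓ^ n ]
  mod-neg {i} {j} (congruent h) = congruent (subst (_ ∣_) (lem i j) (∣m⇒∣-m h)) where
    lem : ∀ i j → ℤ.- (i ℤ.- j) ≡ ℤ.- i ℤ.- (ℤ.- j)
    lem = solve-∀

  mod-* : ∀ {i j k l n} → i ≡ j [modℓ^ n ] → k ≡ l [modℓ^ n ] →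
          i ℤ.* k ≡ j ℤ.* l [modℓ^ n ]
  mod-* {i} {j} {k} {l} (congruent h) (congruent h′) = congruent (subst (_ ∣_) (lem i j k l)
    (∣m∣n⇒∣m+n (∣m⇒∣m*n k h) (∣n⇒∣m*n j h′))) where
    lem : ∀ i j k l → (i ℤ.- j) ℤ.* k ℤ.+ j ℤ.* (k ℤ.- l) ≡ (i ℤ.* k) ℤ.- (j ℤ.* l)
    lem = solve-∀

  mod-falling : ∀ {i j n} → i ≡ j [modℓ^ n ] → ∀ r → falling i r ≡ falling j r [modℓ^ n ]
  mod-falling {n = n} h zero    = mod-refl n refl
  mod-falling {n = n} h (suc r) = mod-* (mod-falling h r) (mod-+ h (mod-refl n refl))

  ^-monoʳ-∣ : ∀ {m n} → m ℕ.≤ n → ℓ ^ m ℕ.∣ ℓ ^ n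
  ^-monoʳ-∣ {m} {n} m≤n = subst (ℓ ^ m ℕ.∣_)
    (trans (sym (ℕ.^-distribˡ-+-* ℓ m (n ∸ m))) (cong (ℓ ^_) (ℕ.m+[n∸m]≡n m≤n)))
    (ℕ.m∣m*n (ℓ ^ (n ∸ m)))

  mod-weaken : ∀ {i j m n} → m ℕ.≤ n → i ≡ j [modℓ^ n ] → i ≡ j [modℓ^ m ]
  mod-weaken m≤n (congruent h) = congruent (∣-trans (∣ᵤ⇒∣ (^-monoʳ-∣ m≤n)) h)

  cancel-coprime : ∀ n {c d} → ¬ (ℓ ℕ.∣ c) → ℓ ^ n ℕ.∣ c ℕ.* d → ℓ ^ n ℕ.∣ d
  cancel-coprime zero    ℓ∤c h = ℕ.1∣ _
  cancel-coprime (suc n) {c} {d} ℓ∤c h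
    with euclidsLemma c d ℓ-prime (ℕ.m*n∣⇒m∣ ℓ (ℓ ^ n) h)
  ... | inj₁ ℓ∣c = contradiction ℓ∣c ℓ∤c
  ... | inj₂ (ℕ.divides q refl) =
    subst (ℓ ^ suc n ℕ.∣_) (ℕ.*-comm ℓ q) (ℕ.*-monoʳ-∣ ℓ (cancel-coprime n ℓ∤c
      (ℕ.*-cancelˡ-∣ ℓ (subst (ℓ ^ suc n ℕ.∣_) eq h))))
    where
    eq : c ℕ.* (q ℕ.* ℓ) ≡ ℓ ℕ.* (c ℕ.* q)
    eq = trans (sym (ℕ.*-assoc c q ℓ)) (ℕ.*-comm (c ℕ.* q) ℓ)

  -- uses that the ℓ-adic valuation of c is less than c
  cancel : ∀ fuel k {c d} .{{_ : NonZero c}} → c ℕ.≤ fuel →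
           ℓ ^ (k ℕ.+ c) ℕ.∣ c ℕ.* d → ℓ ^ k ℕ.∣ d
  cancel zero k {suc _} () h
  cancel (suc fuel) k {c} {d} c≤ h with ℓ ℕ.∣? c
  ... | no ℓ∤c = ℕ.∣-trans (^-monoʳ-∣ (ℕ.m≤m+n k c))
                   (cancel-coprime (k ℕ.+ c) ℓ∤c h)
  ... | yes (ℕ.divides (suc q) refl) =
    cancel fuel k {suc q} {d} (ℕ.s≤s⁻¹ (ℕ.<-≤-trans q<c c≤))
      (ℕ.∣-trans (^-monoʳ-∣ k+q≤) (ℕ.*-cancelˡ-∣ ℓ (subst₂ ℕ._∣_ eq₁ eq₂ h)))
    where
    instance _ = prime⇒nonTrivial ℓ-prime
    q<c : suc q ℕ.< suc q ℕ.* ℓ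
    q<c = ℕ.m<m*n (suc q) ℓ (ℕ.nonTrivial⇒n>1 ℓ)
    r = ℕ.pred (suc q ℕ.* ℓ)
    instance _ = ℕ.m*n≢0 (suc q) ℓ
    k+q≤ : k ℕ.+ suc q ℕ.≤ k ℕ.+ r
    k+q≤ = ℕ.+-monoʳ-≤ k (ℕ.<⇒≤pred q<c)
    eq₁ : ℓ ^ (k ℕ.+ suc q ℕ.* ℓ) ≡ ℓ ℕ.* ℓ ^ (k ℕ.+ r)
    eq₁ = cong (ℓ ^_) (trans (cong (k ℕ.+_) (sym (ℕ.suc-pred (suc q ℕ.* ℓ)))) (ℕ.+-suc k r))
    eq₂ : suc q ℕ.* ℓ ℕ.* d ≡ ℓ ℕ.* (suc q ℕ.* d)
    eq₂ = trans (cong (ℕ._* d) (ℕ.*-comm (suc q) ℓ)) (ℕ.*-assoc ℓ (suc q) d)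

  mod-binomial : ∀ {i j} k n → i ≡ j [modℓ^ k ℕ.+ n ! ] →
                 binomialℤ i n ≡ binomialℤ j n [modℓ^ k ]
  mod-binomial {i} {j} k n h = congruent (∣ᵤ⇒∣ (cancel (n !) k {n !} {{n ℕ.!≢0}} ℕ.≤-refl
    (subst (ℓ ^ (k ℕ.+ n !) ℕ.∣_) (trans (cong ℤ.∣_∣ eq) (ℤ.abs-* (+ (n !)) _))
      (∣⇒∣ᵤ (divides-difference (mod-falling h n))))))
    where
    lem : ∀ p q r → p ℤ.* r ℤ.- q ℤ.* r ≡ r ℤ.* (p ℤ.- q)
    lem = solve-∀
    eq : falling i n ℤ.- falling j n ≡ + (n !) ℤ.* (binomialℤ i n ℤ.- binomialℤ j n)
    eq = trans (cong₂ ℤ._-_ (_∣_.equality (!∣falling i n)) (_∣_.equality (!∣falling j n)))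
               (lem (binomialℤ i n) (binomialℤ j n) (+ (n !)))

  record ℤₗ : Set where
    field
      residue  : ℕ → ℤ
      coherent : ∀ n → residue (suc n) ≡ residue n [modℓ^ n ]
  open ℤₗ public

  infix 4 _≈ₗ_

  record _≈ₗ_ (x y : ℤₗ) : Set where
    constructor ≈-intro
    field residue-≡ : ∀ n → residue x n ≡ residue y n [modℓ^ n ]
  open _≈ₗ_ public

  residue-+ : ∀ x m n → residue x (m ℕ.+ n) ≡ residue x m [modℓ^ m ]
  residue-+ x m zero    = mod-refl m (cong (residue x) (ℕ.+-identityʳ m))
  residue-+ x m (suc n) = mod-trans
    (mod-trans (mod-refl m (cong (residue x) (ℕ.+-suc m n)))
               (mod-weaken (ℕ.m≤m+n m n) (coherent x (m ℕ.+ n))))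
    (residue-+ x m n)

  ι : ℤ → ℤₗ
  ι i = record { residue = λ _ → i ; coherent = λ n → mod-refl n refl }

  ≈-reflexive : ∀ {x y} → (∀ n → residue x n ≡ residue y n) → x ≈ₗ y
  ≈-reflexive h = ≈-intro λ n → mod-refl n (h n)

  ℤₗ-commutativeRing : CommutativeRing 0ℓ 0ℓ
  ℤₗ-commutativeRing = record
    { Carrier = ℤₗ
    ; _≈_ = _≈ₗ_
    ; _+_ = λ x y → record
        { residue  = λ n → residue x n ℤ.+ residue y n
        ; coherent = λ n → mod-+ (coherent x n) (coherent y n) }
    ; _*_ = λ x y → record
        { residue  = λ n → residue x n ℤ.* residue y n
        ; coherent = λ n → mod-* (coherent x n) (coherent y n) }
    ; -_  = λ x → record
        { residue  = λ n → ℤ.- residue x n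
        ; coherent = λ n → mod-neg (coherent x n) }
    ; 0#  = ι 0ℤ
    ; 1#  = ι 1ℤ
    ; isCommutativeRing = record
      { isRing = record
        { +-isAbelianGroup = record
          { isGroup = record
            { isMonoid = record
              { isSemigroup = record
                { isMagma = record
                  { isEquivalence = record
                    { refl  = ≈-reflexive λ _ → refl
                    ; sym   = λ h → ≈-intro λ n → mod-sym (residue-≡ h n)
                    ; trans = λ h h′ → ≈-intro λ n → mod-trans (residue-≡ h n) (residue-≡ h′ n) }
                  ; ∙-cong = λ h h′ → ≈-intro λ n → mod-+ (residue-≡ h n) (residue-≡ h′ n) }
                ; assoc = λ x y z → ≈-reflexive λ n → ℤ.+-assoc (residue x n) (residue y n) (residue z n) }
              ; identity = (λ x → ≈-reflexive λ n → ℤ.+-identityˡ (residue x n))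
                         , (λ x → ≈-reflexive λ n → ℤ.+-identityʳ (residue x n)) }
            ; inverse = (λ x → ≈-reflexive λ n → ℤ.+-inverseˡ (residue x n))
                      , (λ x → ≈-reflexive λ n → ℤ.+-inverseʳ (residue x n))
            ; ⁻¹-cong = λ h → ≈-intro λ n → mod-neg (residue-≡ h n) }
          ; comm = λ x y → ≈-reflexive λ n → ℤ.+-comm (residue x n) (residue y n) }
        ; *-cong = λ h h′ → ≈-intro λ n → mod-* (residue-≡ h n) (residue-≡ h′ n)
        ; *-assoc = λ x y z → ≈-reflexive λ n → ℤ.*-assoc (residue x n) (residue y n) (residue z n)
        ; *-identity = (λ x → ≈-reflexive λ n → ℤ.*-identityˡ (residue x n))
                     , (λ x → ≈-reflexive λ n → ℤ.*-identityʳ (residue x n))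
        ; distrib =
            (λ x y z → ≈-reflexive λ n → ℤ.*-distribˡ-+ (residue x n) (residue y n) (residue z n))
          , (λ x y z → ≈-reflexive λ n → ℤ.*-distribʳ-+ (residue x n) (residue y n) (residue z n)) }
      ; *-comm = λ x y → ≈-reflexive λ n → ℤ.*-comm (residue x n) (residue y n) } }

  private
    module Z = CommutativeRing ℤₗ-commutativeRing
    module ZD = RawSemiringDefinitions (RawRing.rawSemiring Z.rawRing)

  open ZD public using () renaming (_∣_ to _∣ₗ_)

  -- Reading b to precision k + n! determines the quotient by n! to
  -- precision k, because the ℓ-adic valuation of n! is less than n!.
  binomial : ℤₗ → ℕ → ℤₗ
  binomial b n = record
    { residue  = λ k → binomialℤ (residue b (k ℕ.+ n !)) n
    ; coherent = λ k → mod-binomial k n (coherent b (k ℕ.+ n !)) }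

  fallingₗ : ℤₗ → ℕ → ℤₗ
  fallingₗ b zero    = Z.1#
  fallingₗ b (suc n) = fallingₗ b n Z.* (b Z.- ι (+ n))

  n!*binomial : ∀ b n → ι (+ (n !)) Z.* binomial b n Z.≈ fallingₗ b n
  n!*binomial b n = ≈-intro λ k → subst₂ (λ i j → i ≡ j [modℓ^ k ])
    (trans (_∣_.equality (!∣falling (residue b (k ℕ.+ n !)) n)) (ℤ.*-comm _ (+ (n !))))
    (sym (residue-falling k n))
    (mod-falling (residue-+ b k (n !)) n)
    where
    residue-falling : ∀ k n → residue (fallingₗ b n) k ≡ falling (residue b k) n
    residue-falling k zero    = refl
    residue-falling k (suc n) = cong (ℤ._* (residue b k ℤ.- + n)) (residue-falling k n)

  ----------------------------------------------------------------------
  -- The characteristic series of a bouquet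

  open PowerSeries Z.rawRing public

  private
    module S = RawRing seriesRawRing
    module SD = RawSemiringDefinitions S.rawSemiring

  [1+T]^_ : ℤₗ → Series
  [1+T]^ b = binomial b

  characteristicSeries : ∀ {t} → Vector ℤₗ t → Series
  characteristicSeries α = SD.sum λ j →
    (const (ι (+ 2)) S.+ S.- ([1+T]^ α j)) S.+ S.- ([1+T]^ (Z.- α j))

  Admissible : ∀ {t} → Pred (Vector ℤₗ t) 0ℓ
  Admissible α = ¬ (∀ j → ι (+ ℓ) ∣ₗ α j)

  -- By uniqueness in the Weierstrass preparation theorem, μ does not
  -- depend on the chosen factorization.
  μ-positive : ∀ {t} → Pred (Vector ℤₗ t) 0ℓ
  μ-positive α =
    Σ[ W ∈ WeierstrassFactorization (ι (+ ℓ)) (characteristicSeries α) ]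
      0 ℕ.< WeierstrassFactorization.μ W

------------------------------------------------------------------------
-- Upper real numbers

-- An extended real number x, given by the set of rationals q with x < q.
record UpperReal : Set₁ where
  field
    below   : ℚ → Set
    upward  : ∀ {p q} → p ℚ.< q → below p → below q
    rounded : ∀ {q} → below q → ∃[ p ] (p ℚ.< q × below p)
open UpperReal public

infix 4 _≤ᵘ_

_≤ᵘ_ : UpperReal → ℚ → Set
x ≤ᵘ q = ∀ r → q ℚ.< r → below x r

infixl 7 _÷ᵘ_

_÷ᵘ_ : UpperReal → (c : ℚ) .{{_ : Positive c}} → UpperReal
x ÷ᵘ c = record
  { below   = λ q → below x (q ℚ.* c)
  ; upward  = λ p<q → upward x (ℚ.*-monoˡ-<-pos c p<q)
  ; rounded = λ {q} h → let p , p<qc , h′ = rounded x h in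
      p ℚ.* 1/c
    , ℚ.*-cancelʳ-<-nonNeg c {{ℚ.pos⇒nonNeg c}} (subst (ℚ._< q ℚ.* c) (sym (cancel p)) p<qc)
    , subst (below x) (sym (cancel p)) h′
  }
  where
  instance _ = ℚ.pos⇒nonZero c
  1/c = ℚ.1/ c
  cancel : ∀ p → p ℚ.* 1/c ℚ.* c ≡ p
  cancel p = trans (ℚ.*-assoc p 1/c c)
    (trans (cong (p ℚ.*_) (ℚ.*-inverseˡ c)) (ℚ.*-identityʳ p))

------------------------------------------------------------------------
-- Finite sums of rationals

∑ : ∀ {A : Set} → List A → (A → ℚ) → ℚ
∑ xs f = List.foldr ℚ._+_ 0ℚ (List.map f xs)

infix 5 ∑
syntax ∑ xs (λ x → e) = ∑[ x ∈ xs ] e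

-- 1, …, n
oneTo : ℕ → List ℕ
oneTo n = List.map suc (upTo n)

-- the tuples (a₁, …, aₘ) of natural numbers with a₁ + ⋯ + aₘ = n
tuplesOfSum : (m n : ℕ) → List (Vec ℕ m)
tuplesOfSum zero    zero    = [] ∷ []
tuplesOfSum zero    (suc _) = []
tuplesOfSum (suc m) n       =
  concatMap (λ a → List.map (a ∷_) (tuplesOfSum m (n ∸ a))) (upTo (suc n))

-- (a₁ ℓ)! ⋯ (aₘ ℓ)!
∏! : ℕ → ∀ {m} → Vec ℕ m → ℕ
∏! ℓ as = product (List.map (λ a → (a ℕ.* ℓ) !) (Vec.toList as))

module _ (ℓ : ℕ) (ℓ-prime : Prime ℓ) (t : ℕ) .{{_ : NonZero t}} where

  private instance
    ℓ-nonZero : NonZero ℓ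
    ℓ-nonZero = prime⇒nonZero ℓ-prime

  1<ℓ^t : 1 ℕ.< ℓ ^ t
  1<ℓ^t = ℕ.<-≤-trans (ℕ.nonTrivial⇒n>1 ℓ {{prime⇒nonTrivial ℓ-prime}})
            (subst (ℕ._≤ ℓ ^ t) (ℕ.^-identityʳ ℓ) (ℕ.^-monoʳ-≤ ℓ (ℕ.>-nonZero⁻¹ t)))

  denominator≢0 : ∀ {m} (as : Vec ℕ m) → NonZero ((ℓ ^ t ∸ 1) ℕ.* ∏! ℓ as)
  denominator≢0 as = ℕ.m*n≢0 (ℓ ^ t ∸ 1) (∏! ℓ as)
    {{ℕ.>-nonZero (ℕ.m<n⇒0<n∸m 1<ℓ^t)}}
    {{product≢0 (All.map⁺ (All.universal (λ a → (a ℕ.* ℓ) ℕ.!≢0) (Vec.toList as)))}}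

------------------------------------------------------------------------
-- Haar measure on ℤₗᵗ

module Haar (ℓ : ℕ) (ℓ-prime : Prime ℓ) (t : ℕ) where

  open ℓ-adic ℓ ℓ-prime
  private
    module Z = CommutativeRing ℤₗ-commutativeRing
    instance
      ℓ-nonZero : NonZero ℓ
      ℓ-nonZero = prime⇒nonZero ℓ-prime

  -- the coset centre + (ℓ ^ level) ℤₗᵗ
  record Ball : Set where
    field
      centre : Vector ℤₗ t
      level  : ℕ
  open Ball public

  _∈ᵇ_ : Vector ℤₗ t → Ball → Set
  α ∈ᵇ B = ∀ j → ι (+ (ℓ ^ level B)) ∣ₗ (α j Z.- centre B j)

  volume : Ball → ℚ
  volume B = (+ 1 ℚ./ ℓ ^ (level B ℕ.* t)) {{ℕ.m^n≢0 ℓ (level B ℕ.* t)}}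

  -- A countable (possibly finite) family of balls covering S.
  record Cover (S : Pred (Vector ℤₗ t) 0ℓ) : Set where
    field
      ball   : ℕ → Maybe Ball
      covers : ∀ {α} → α ∈ S → ∃[ n ] Maybe.Any (α ∈ᵇ_) (ball n)

    totalVolumeUpTo : ℕ → ℚ
    totalVolumeUpTo N = ∑[ n ∈ upTo N ] maybe′ volume 0ℚ (ball n)
  open Cover public

  -- The normalized Haar measure, extended to all sets as the outer
  -- measure it induces: the infimum of the total volume over all
  -- countable covers by balls, the volume of a ball being the
  -- reciprocal of the index of ℓ ^ level ℤₗᵗ in ℤₗᵗ.  On Borel sets this
  -- infimum is the measure.
  τ : Pred (Vector ℤₗ t) 0ℓ → UpperReal
  τ S = record
    { below   = λ q → ∃[ p ] (p ℚ.< q × HasCoverOfVolume≤ p)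
    ; upward  = λ q<r (p , p<q , h) → p , ℚ.<-trans p<q q<r , h
    ; rounded = λ (p , p<q , h) →
        let r , p<r , r<q = ℚ.<-dense p<q in r , r<q , p , p<r , h
    }
    where
    HasCoverOfVolume≤ : ℚ → Set
    HasCoverOfVolume≤ p = Σ[ c ∈ Cover S ] (∀ N → totalVolumeUpTo c N ℚ.≤ p)

  -- 1 - ℓ ^ (- t), the measure of the set of admissible vectors
  admissibleVolume : ℚ
  admissibleVolume = 1ℚ ℚ.- (+ 1 ℚ./ ℓ ^ t) {{ℕ.m^n≢0 ℓ t}}

  admissibleVolume-positive : .{{_ : NonZero t}} → Positive admissibleVolume
  admissibleVolume-positive = ℚ.positive
    (subst (ℚ._< admissibleVolume) (ℚ.+-inverseʳ v) (ℚ.+-monoˡ-< (ℚ.- v) v<1))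
    where
    instance _ = ℕ.m^n≢0 ℓ t
    v = + 1 ℚ./ ℓ ^ t
    lt : ∀ n .{{_ : NonZero n}} → 1 ℕ.< n → + 1 ℚ./ n ℚ.< 1ℚ
    lt (suc n) 1<n = ℚ.toℚᵘ-cancel-<
      (ℚᵘ.<-respˡ-≃ (ℚᵘ.≃-sym (ℚ.toℚᵘ-fromℚᵘ (ℚᵘ.mkℚᵘ (+ 1) n)))
        (ℚᵘ.*<* (subst (1ℤ ℤ.<_) (sym (ℤ.*-identityˡ (+ suc n))) (ℤ.+<+ 1<n))))
    v<1 : v ℚ.< 1ℚ
    v<1 = lt (ℓ ^ t) (1<ℓ^t ℓ ℓ-prime t)

  Prob[μ>0] : .{{_ : NonZero t}} → UpperReal
  Prob[μ>0] = (τ λ α → Admissible α × μ-positive α) ÷ᵘ admissibleVolume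
    where instance _ = admissibleVolume-positive

{-# OPTIONS --safe #-}
module Submission where

-- The set of vectors with μ > 0 has measure zero, so it suffices that the
-- bound is nonnegative.  Indeed μ > 0 means that f ≡ 0 (mod ℓ), and then
-- (1+T)^α₁ + (1+T)^(-α₁) is determined modulo ℓ by α₂, …, αₜ.  Since
-- X + X⁻¹ - Y - Y⁻¹ = X⁻¹ (XY - 1) (XY⁻¹ - 1), and (1+T)ⁿ - 1 has order
-- ℓ^v in 𝔽_ℓ[[T]], v being the ℓ-adic valuation of n, this determines α₁
-- up to sign.  Truncated at order 2ℓ^k + 1 in T, the argument determines α₁
-- up to sign modulo ℓ^k from a finite approximation of α₂, …, αₜ, which
-- yields a finite cover by balls of total volume at most 2ℓ^(-k).

open import Defs
open import Algebra.Bundles using (RawRing; CommutativeRing)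
import Algebra.Definitions.RawSemiring as RawSemiringDefinitions
open import Data.Fin.Base as Fin using (Fin; toℕ; zero; suc; combine; remQuot; finToFun; funToFin; fromℕ<)
import Data.Fin.Properties as Fin
open import Data.Integer.Base as ℤ using (ℤ; +_; 0ℤ; 1ℤ)
open import Data.Integer.Divisibility.Signed
open import Data.Integer.DivMod using (_%ℕ_; _/ℕ_; n%ℕd<d; a≡a%ℕn+[a/ℕn]*n)
import Data.Integer.Properties as ℤ
open import Data.Integer.Tactic.RingSolver using (solve-∀)
open import Data.List.Base using (List; []; _∷_; applyUpTo)
open import Data.Maybe.Base using (Maybe; just; nothing; maybe′)
import Data.Maybe.Relation.Unary.Any as Maybe
open import Data.Nat.Base as ℕ using (ℕ; zero; suc; NonZero; _≤_; _<_; z≤n; s≤s; _*_; _^_; _∸_; _!; _/_)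
open import Data.Nat.Combinatorics using (_C_)
import Data.Nat.Divisibility as ℕ
open import Data.Nat.Induction using (<-rec)
open import Data.Nat.Primality using (Prime; prime⇒nonZero; prime⇒nonTrivial; euclidsLemma)
import Data.Nat.Properties as ℕ
import Data.Nat.Tactic.RingSolver as ℕ
open import Data.Product.Base using (∃-syntax; Σ-syntax; _×_; _,_)
open import Data.Rational.Base as ℚ using (ℚ; 0ℚ; Positive)
import Data.Rational.Properties as ℚ
import Data.Rational.Unnormalised.Base as ℚᵘ
import Data.Rational.Unnormalised.Properties as ℚᵘ
open import Data.Sum.Base using (_⊎_; inj₁; inj₂; [_,_]′)
open import Data.Vec.Functional using (Vector) renaming (_∷_ to _∷ᶠ_)
open import Function.Base using (_∘_; id)
open import Level using (0ℓ)
open import Relation.Binary.PropositionalEquality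
open import Relation.Nullary using (¬_; yes; no; contradiction)
import Relation.Nullary.Decidable as Dec
open import Relation.Unary using (Pred; Decidable)

-- Binomial series with integer coefficients

falling-suc : ∀ b n → falling (ℤ.suc b) (suc n) ≡ ℤ.suc b ℤ.* falling b n
falling-suc b zero = lem b
  where
  lem : ∀ b → 1ℤ ℤ.* ((1ℤ ℤ.+ b) ℤ.- 0ℤ) ≡ (1ℤ ℤ.+ b) ℤ.* 1ℤ
  lem = solve-∀
falling-suc b (suc n) =
  trans (cong₂ (λ x y → x ℤ.* (ℤ.suc b ℤ.- y)) (falling-suc b n) (ℤ.pos-+ 1 n))
        (lem b (falling b n) (+ n))
  where
  lem : ∀ b F n → ((1ℤ ℤ.+ b) ℤ.* F) ℤ.* ((1ℤ ℤ.+ b) ℤ.- (1ℤ ℤ.+ n))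
                ≡ (1ℤ ℤ.+ b) ℤ.* (F ℤ.* (b ℤ.- n))
  lem = solve-∀

falling≡! : ∀ b n → falling b n ≡ binomialℤ b n ℤ.* + (n !)
falling≡! b n = _∣_.equality (!∣falling b n)

-- `binomialℤ` is specified only as a quotient by n!, so identities between its values are proved
-- after multiplication by n!, where they concern `falling`.
!-cancel : ∀ n {i j} → i ℤ.* + (n !) ≡ j ℤ.* + (n !) → i ≡ j
!-cancel n {i} {j} = ℤ.*-cancelʳ-≡ i j (+ (n !)) {{n ℕ.!≢0}}

binomialℤ-zero : ∀ b → binomialℤ b 0 ≡ 1ℤ
binomialℤ-zero b = !-cancel 0 (sym (falling≡! b 0))

pos-! : ∀ n → + (suc n !) ≡ + suc n ℤ.* + (n !)
pos-! n = ℤ.pos-* (suc n) (n !)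

binomialℤ-absorption : ∀ b n →
  + suc n ℤ.* binomialℤ (ℤ.suc b) (suc n) ≡ ℤ.suc b ℤ.* binomialℤ b n
binomialℤ-absorption b n = !-cancel n (begin
  + suc n ℤ.* B′ ℤ.* + (n !)                    ≡⟨ lem (+ suc n) B′ (+ (n !)) ⟩
  B′ ℤ.* (+ suc n ℤ.* + (n !))                  ≡⟨ cong (B′ ℤ.*_) (pos-! n) ⟨
  B′ ℤ.* + (suc n !)                            ≡⟨ falling≡! (ℤ.suc b) (suc n) ⟨
  falling (ℤ.suc b) (suc n)                     ≡⟨ falling-suc b n ⟩
  ℤ.suc b ℤ.* falling b n                       ≡⟨ cong (ℤ.suc b ℤ.*_) (falling≡! b n) ⟩
  ℤ.suc b ℤ.* (binomialℤ b n ℤ.* + (n !))       ≡⟨ ℤ.*-assoc (ℤ.suc b) _ _ ⟨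
  ℤ.suc b ℤ.* binomialℤ b n ℤ.* + (n !)         ∎)
  where
  open ≡-Reasoning
  B′ = binomialℤ (ℤ.suc b) (suc n)
  lem : ∀ s B f → s ℤ.* B ℤ.* f ≡ B ℤ.* (s ℤ.* f)
  lem = solve-∀

-- Absorption with the common factor q + 1 cancelled. For q + 1 = ℓ^a it relates C(uℓ^a, ℓ^a) to
-- C(uℓ^a - 1, ℓ^a - 1).
binomialℤ-quotient : ∀ u n q → suc n ≡ u * suc q →
                     binomialℤ (+ suc n) (suc q) ≡ + u ℤ.* binomialℤ (+ n) q
binomialℤ-quotient u n q 1+n≡ = ℤ.*-cancelˡ-≡ (+ suc q) _ _ (begin
  + suc q ℤ.* binomialℤ (+ suc n) (suc q)   ≡⟨ binomialℤ-absorption (+ n) q ⟩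
  + suc n ℤ.* binomialℤ (+ n) q             ≡⟨ cong (λ x → + x ℤ.* binomialℤ (+ n) q) 1+n≡ ⟩
  + (u * suc q) ℤ.* binomialℤ (+ n) q       ≡⟨ cong (ℤ._* binomialℤ (+ n) q) (ℤ.pos-* u (suc q)) ⟩
  + u ℤ.* + suc q ℤ.* binomialℤ (+ n) q     ≡⟨ lem (+ u) (+ suc q) _ ⟩
  + suc q ℤ.* (+ u ℤ.* binomialℤ (+ n) q)   ∎)
  where
  open ≡-Reasoning
  lem : ∀ x s B → x ℤ.* s ℤ.* B ≡ s ℤ.* (x ℤ.* B)
  lem = solve-∀

binomialℤ-pascal : ∀ b n →
  binomialℤ (ℤ.suc b) (suc n) ≡ binomialℤ b (suc n) ℤ.+ binomialℤ b n
binomialℤ-pascal b n = !-cancel (suc n) (begin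
  binomialℤ (ℤ.suc b) (suc n) ℤ.* + (suc n !)
    ≡⟨ falling≡! (ℤ.suc b) (suc n) ⟨
  falling (ℤ.suc b) (suc n)
    ≡⟨ falling-suc b n ⟩
  ℤ.suc b ℤ.* falling b n
    ≡⟨ lem₁ b (falling b n) (+ n) ⟩
  falling b (suc n) ℤ.+ (1ℤ ℤ.+ + n) ℤ.* falling b n
    ≡⟨ cong₂ (λ x y → x ℤ.+ y ℤ.* falling b n) (falling≡! b (suc n)) (sym (ℤ.pos-+ 1 n)) ⟩
  binomialℤ b (suc n) ℤ.* + (suc n !) ℤ.+ + suc n ℤ.* falling b n
    ≡⟨ cong (λ x → binomialℤ b (suc n) ℤ.* + (suc n !) ℤ.+ + suc n ℤ.* x) (falling≡! b n) ⟩
  binomialℤ b (suc n) ℤ.* + (suc n !) ℤ.+ + suc n ℤ.* (binomialℤ b n ℤ.* + (n !))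
    ≡⟨ cong (λ x → binomialℤ b (suc n) ℤ.* x ℤ.+ + suc n ℤ.* (binomialℤ b n ℤ.* + (n !))) (pos-! n) ⟩
  binomialℤ b (suc n) ℤ.* (+ suc n ℤ.* + (n !)) ℤ.+ + suc n ℤ.* (binomialℤ b n ℤ.* + (n !))
    ≡⟨ lem₂ (binomialℤ b (suc n)) (binomialℤ b n) (+ suc n) (+ (n !)) ⟩
  (binomialℤ b (suc n) ℤ.+ binomialℤ b n) ℤ.* (+ suc n ℤ.* + (n !))
    ≡⟨ cong ((binomialℤ b (suc n) ℤ.+ binomialℤ b n) ℤ.*_) (pos-! n) ⟨
  (binomialℤ b (suc n) ℤ.+ binomialℤ b n) ℤ.* + (suc n !) ∎)
  where
  open ≡-Reasoning
  lem₁ : ∀ b F n → (1ℤ ℤ.+ b) ℤ.* F ≡ F ℤ.* (b ℤ.- n) ℤ.+ (1ℤ ℤ.+ n) ℤ.* F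
  lem₁ = solve-∀
  lem₂ : ∀ x y s f → x ℤ.* (s ℤ.* f) ℤ.+ s ℤ.* (y ℤ.* f) ≡ (x ℤ.+ y) ℤ.* (s ℤ.* f)
  lem₂ = solve-∀

binomialℤ-0-suc : ∀ n → binomialℤ 0ℤ (suc n) ≡ 0ℤ
binomialℤ-0-suc n = !-cancel (suc n) (trans (sym (falling≡! 0ℤ (suc n))) (falling-0 n))
  where
  falling-0 : ∀ n → falling 0ℤ (suc n) ≡ 0ℤ
  falling-0 zero    = refl
  falling-0 (suc n) = cong (ℤ._* (0ℤ ℤ.- + suc n)) (falling-0 n)

-- Coefficients of the product of the power series with coefficients c and f.
conv : (ℕ → ℤ) → (ℕ → ℤ) → ℕ → ℤ
conv c f zero    = c 0 ℤ.* f 0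
conv c f (suc n) = c 0 ℤ.* f (suc n) ℤ.+ conv (c ∘ suc) f n

conv-cong : ∀ {c c′} → (∀ i → c i ≡ c′ i) → ∀ f n → conv c f n ≡ conv c′ f n
conv-cong h f zero    = cong (ℤ._* f 0) (h 0)
conv-cong h f (suc n) =
  cong₂ ℤ._+_ (cong (ℤ._* f (suc n)) (h 0)) (conv-cong (h ∘ suc) f n)

conv-distribʳ-+ : ∀ c c′ f n → conv (λ i → c i ℤ.+ c′ i) f n ≡ conv c f n ℤ.+ conv c′ f n
conv-distribʳ-+ c c′ f zero    = ℤ.*-distribʳ-+ (f 0) (c 0) (c′ 0)
conv-distribʳ-+ c c′ f (suc n) =
  trans (cong (λ z → (c 0 ℤ.+ c′ 0) ℤ.* f (suc n) ℤ.+ z) (conv-distribʳ-+ (c ∘ suc) (c′ ∘ suc) f n))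
        (lem (c 0) (c′ 0) (f (suc n)) _ _)
  where
  lem : ∀ a b x u v → (a ℤ.+ b) ℤ.* x ℤ.+ (u ℤ.+ v) ≡ (a ℤ.* x ℤ.+ u) ℤ.+ (b ℤ.* x ℤ.+ v)
  lem = solve-∀

conv-distribˡ-- : ∀ c f g n → conv c (λ i → f i ℤ.- g i) n ≡ conv c f n ℤ.- conv c g n
conv-distribˡ-- c f g zero = lem (c 0) (f 0) (g 0)
  where
  lem : ∀ a x y → a ℤ.* (x ℤ.- y) ≡ a ℤ.* x ℤ.- a ℤ.* y
  lem = solve-∀
conv-distribˡ-- c f g (suc n) =
  trans (cong (λ z → c 0 ℤ.* (f (suc n) ℤ.- g (suc n)) ℤ.+ z) (conv-distribˡ-- (c ∘ suc) f g n))
        (lem (c 0) (f (suc n)) (g (suc n)) _ _)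
  where
  lem : ∀ a x y u v → a ℤ.* (x ℤ.- y) ℤ.+ (u ℤ.- v) ≡ (a ℤ.* x ℤ.+ u) ℤ.- (a ℤ.* y ℤ.+ v)
  lem = solve-∀

conv-distribˡ-+ : ∀ c f g n → conv c (λ i → f i ℤ.+ g i) n ≡ conv c f n ℤ.+ conv c g n
conv-distribˡ-+ c f g zero    = ℤ.*-distribˡ-+ (c 0) (f 0) (g 0)
conv-distribˡ-+ c f g (suc n) =
  trans (cong (λ z → c 0 ℤ.* (f (suc n) ℤ.+ g (suc n)) ℤ.+ z) (conv-distribˡ-+ (c ∘ suc) f g n))
        (lem (c 0) (f (suc n)) (g (suc n)) _ _)
  where
  lem : ∀ a x y u v → a ℤ.* (x ℤ.+ y) ℤ.+ (u ℤ.+ v) ≡ (a ℤ.* x ℤ.+ u) ℤ.+ (a ℤ.* y ℤ.+ v)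
  lem = solve-∀

conv-0 : ∀ {c} → (∀ i → c i ≡ 0ℤ) → ∀ f n → conv c f n ≡ 0ℤ
conv-0 h f zero    = cong (ℤ._* f 0) (h 0)
conv-0 h f (suc n) = cong₂ ℤ._+_ (cong (ℤ._* f (suc n)) (h 0)) (conv-0 (h ∘ suc) f n)

-- This is (1+T)ⁿ (1+T)ʸ = (1+T)ⁿ⁺ʸ. The first exponent is natural to allow induction by Pascal's
-- rule; the second may be negative, so that inverses (1+T)⁻ˣ are covered.
vandermonde : ∀ n y j → conv (binomialℤ (+ n)) (binomialℤ y) j ≡ binomialℤ (+ n ℤ.+ y) j
vandermonde zero y j = trans (unit j) (cong (λ x → binomialℤ x j) (sym (ℤ.+-identityˡ y)))
  where
  unit : ∀ j → conv (binomialℤ 0ℤ) (binomialℤ y) j ≡ binomialℤ y j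
  unit zero    = trans (cong (ℤ._* binomialℤ y 0) (binomialℤ-zero 0ℤ)) (ℤ.*-identityˡ _)
  unit (suc j) = trans (cong₂ ℤ._+_
    (trans (cong (ℤ._* binomialℤ y (suc j)) (binomialℤ-zero 0ℤ)) (ℤ.*-identityˡ _))
    (conv-0 binomialℤ-0-suc (binomialℤ y) j)) (ℤ.+-identityʳ _)
vandermonde (suc n) y zero = trans
  (cong₂ ℤ._*_ (binomialℤ-zero (+ suc n)) (binomialℤ-zero y))
  (sym (binomialℤ-zero (+ suc n ℤ.+ y)))
vandermonde (suc n) y (suc j) = begin
  c₁ 0 ℤ.* f (suc j) ℤ.+ conv (c₁ ∘ suc) f j
    ≡⟨ cong₂ (λ a x → a ℤ.* f (suc j) ℤ.+ x)
         (trans (binomialℤ-zero (+ suc n)) (sym (binomialℤ-zero (+ n))))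
         -- Pascal's rule on the shifted coefficients expresses multiplication of the first factor
         -- by 1 + T.
         (trans (conv-cong (binomialℤ-pascal (+ n)) f j)
                (conv-distribʳ-+ (c ∘ suc) c f j)) ⟩
  c 0 ℤ.* f (suc j) ℤ.+ (conv (c ∘ suc) f j ℤ.+ conv c f j)
    ≡⟨ ℤ.+-assoc (c 0 ℤ.* f (suc j)) _ _ ⟨
  conv c f (suc j) ℤ.+ conv c f j
    ≡⟨ cong₂ ℤ._+_ (vandermonde n y (suc j)) (vandermonde n y j) ⟩
  binomialℤ (+ n ℤ.+ y) (suc j) ℤ.+ binomialℤ (+ n ℤ.+ y) j
    ≡⟨ binomialℤ-pascal (+ n ℤ.+ y) j ⟨
  binomialℤ (ℤ.suc (+ n ℤ.+ y)) (suc j)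
    ≡⟨ cong (λ x → binomialℤ x (suc j)) (ℤ.+-assoc 1ℤ (+ n) y) ⟨
  binomialℤ (+ suc n ℤ.+ y) (suc j) ∎
  where
  open ≡-Reasoning
  c₁ = binomialℤ (+ suc n)
  c  = binomialℤ (+ n)
  f  = binomialℤ y

conv-∣ : ∀ {k} c {f} n → (∀ i → i ≤ n → k ∣ f i) → k ∣ conv c f n
conv-∣ c zero    h = ∣n⇒∣m*n (c 0) (h 0 z≤n)
conv-∣ c (suc n) h = ∣m∣n⇒∣m+n (∣n⇒∣m*n (c 0) (h (suc n) ℕ.≤-refl))
  (conv-∣ (c ∘ suc) n (λ i i≤n → h i (ℕ.m≤n⇒m≤1+n i≤n)))

-- Lowest terms of power series over ℤ/k multiply.
conv-leading : ∀ {k} c f e j → (∀ i → i < e → k ∣ c i) → (∀ i → i < j → k ∣ f i) →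
               k ∣ conv c f (e ℕ.+ j) ℤ.- c e ℤ.* f j
conv-leading c f zero zero hc hf = divides 0ℤ (ℤ.+-inverseʳ (c 0 ℤ.* f 0))
conv-leading {k} c f zero (suc j) hc hf =
  subst (k ∣_) (lem (c 0 ℤ.* f (suc j)) _)
    (conv-∣ (c ∘ suc) j (λ i i≤j → hf i (s≤s i≤j)))
  where
  lem : ∀ x y → y ≡ (x ℤ.+ y) ℤ.- x
  lem = solve-∀
conv-leading {k} c f (suc e) j hc hf =
  subst (k ∣_) (sym (ℤ.+-assoc (c 0 ℤ.* f (suc (e ℕ.+ j))) _ _))
    (∣m∣n⇒∣m+n (∣m⇒∣m*n _ (hc 0 (s≤s z≤n)))
               (conv-leading (c ∘ suc) f e j (λ i i<e → hc (suc i) (s≤s i<e)) hf))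

-- Volumes of finite covers

nth : ∀ {A : Set} K → (Fin K → A) → ℕ → Maybe A
nth zero    f n       = nothing
nth (suc K) f zero    = just (f zero)
nth (suc K) f (suc n) = nth K (f ∘ suc) n

nth-toℕ : ∀ {A : Set} {K} (f : Fin K → A) i → nth K f (toℕ i) ≡ just (f i)
nth-toℕ f zero    = refl
nth-toℕ f (suc i) = nth-toℕ (f ∘ suc) i

toℚᵘ-/ : ∀ n d .{{_ : NonZero d}} → ℚ.toℚᵘ (+ n ℚ./ d) ℚᵘ.≃ + n ℚᵘ./ d
toℚᵘ-/ n (suc d) = ℚ.toℚᵘ-fromℚᵘ (ℚᵘ.mkℚᵘ (+ n) d)

/-suc : ∀ n d .{{_ : NonZero d}} → (+ 1 ℚ./ d) ℚ.+ (+ n ℚ./ d) ≡ + suc n ℚ./ d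
/-suc n d@(suc _) = ℚ.toℚᵘ-injective (begin-equality
  ℚ.toℚᵘ ((+ 1 ℚ./ d) ℚ.+ (+ n ℚ./ d))              ≃⟨ ℚ.toℚᵘ-homo-+ (+ 1 ℚ./ d) (+ n ℚ./ d) ⟩
  ℚ.toℚᵘ (+ 1 ℚ./ d) ℚᵘ.+ ℚ.toℚᵘ (+ n ℚ./ d)        ≃⟨ ℚᵘ.+-cong (toℚᵘ-/ 1 d) (toℚᵘ-/ n d) ⟩
  (+ 1 ℚᵘ./ d) ℚᵘ.+ (+ n ℚᵘ./ d)                    ≃⟨ ℚᵘ.*≡* (lem (+ n) (+ d)) ⟩
  + suc n ℚᵘ./ d                                    ≃⟨ toℚᵘ-/ (suc n) d ⟨
  ℚ.toℚᵘ (+ suc n ℚ./ d)                            ∎)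
  where
  open ℚᵘ.≤-Reasoning
  lem : ∀ n d → (ℤ.1ℤ ℤ.* d ℤ.+ n ℤ.* d) ℤ.* d ≡ (ℤ.1ℤ ℤ.+ n) ℤ.* (d ℤ.* d)
  lem = solve-∀

0≤/ : ∀ n d .{{_ : NonZero d}} → 0ℚ ℚ.≤ + n ℚ./ d
0≤/ n d = ℚ.nonNegative⁻¹ _ {{ℚ.normalize-nonNeg n d}}

-- A positive p has numerator at least 1, so p ≥ 1 / `ℚ.↧ₙ p`, and it is enough to compare with this
-- unit fraction.
/-≤ : ∀ K D .{{_ : NonZero D}} p .{{_ : Positive p}} → K * ℚ.↧ₙ p ≤ D → + K ℚ./ D ℚ.≤ p
/-≤ K D@(suc _) p@(ℚ.mkℚ (+ suc a) d-1 _) h = ℚ.toℚᵘ-cancel-≤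
  (ℚᵘ.≤-respˡ-≃ (ℚᵘ.≃-sym (toℚᵘ-/ K D)) (ℚᵘ.*≤* (subst₂ ℤ._≤_
    (ℤ.pos-* K (suc d-1)) (ℤ.pos-* (suc a) D) (ℤ.+≤+ (ℕ.≤-trans h (ℕ.m≤n*m D (suc a)))))))

0≤∑ : ∀ {A : Set} (xs : List A) {f} → (∀ x → 0ℚ ℚ.≤ f x) → 0ℚ ℚ.≤ ∑ xs f
0≤∑ []       h = ℚ.≤-refl
0≤∑ (x ∷ xs) h = ℚ.+-mono-≤ (h x) (0≤∑ xs h)

-- At most K entries of the sequence are not `nothing`, and each contributes 1/d. The reindexing `s`
-- makes the induction go through: `upTo N` is `applyUpTo id N`, and passing to its tail replaces
-- `s` by `s ∘ suc`.
∑-nth-≤ : ∀ {A : Set} d .{{_ : NonZero d}} (v : A → ℚ) K (f : Fin K → A) →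
          (∀ i → v (f i) ≡ + 1 ℚ./ d) →
          ∀ N {g} (s : ℕ → ℕ) → (∀ n → g (s n) ≡ maybe′ v 0ℚ (nth K f n)) →
          ∑ (applyUpTo s N) g ℚ.≤ + K ℚ./ d
∑-nth-≤ d v K       f hv zero    s hg = 0≤/ K d
∑-nth-≤ d v zero    f hv (suc N) s hg = ℚ.≤-trans
  (ℚ.+-mono-≤ (ℚ.≤-reflexive (hg 0)) (∑-nth-≤ d v zero f hv N (s ∘ suc) (hg ∘ suc)))
  (ℚ.≤-reflexive (ℚ.+-identityˡ (+ 0 ℚ./ d)))
∑-nth-≤ d v (suc K) f hv (suc N) s hg = ℚ.≤-trans
  (ℚ.+-mono-≤ (ℚ.≤-reflexive (trans (hg 0) (hv zero)))
              (∑-nth-≤ d v K (f ∘ suc) (hv ∘ suc) N (s ∘ suc) (hg ∘ suc)))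
  (ℚ.≤-reflexive (/-suc K d))

n<m^n : ∀ m n → 1 < m → n < m ^ n
n<m^n m zero    1<m = s≤s z≤n
n<m^n m (suc n) 1<m = begin-strict
  suc n        ≤⟨ n<m^n m n 1<m ⟩
  m ^ n        <⟨ ℕ.m<m*n (m ^ n) m {{ℕ.>-nonZero (ℕ.≤-<-trans z≤n (n<m^n m n 1<m))}} 1<m ⟩
  m ^ n * m    ≡⟨ ℕ.*-comm (m ^ n) m ⟩
  m * m ^ n    ∎
  where open ℕ.≤-Reasoning

÷ᵘ-≤0 : ∀ {x} c .{{_ : Positive c}} → x ≤ᵘ 0ℚ → x ÷ᵘ c ≤ᵘ 0ℚ
÷ᵘ-≤0 c x≤0 r 0<r = x≤0 (r ℚ.* c) (subst (ℚ._< r ℚ.* c) (ℚ.*-zeroˡ c) (ℚ.*-monoˡ-<-pos c 0<r))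

≤ᵘ-trans : ∀ {x p q} → x ≤ᵘ p → p ℚ.≤ q → x ≤ᵘ q
≤ᵘ-trans x≤p p≤q r q<r = x≤p r (ℚ.≤-<-trans p≤q q<r)

0≤* : ∀ {p q} → 0ℚ ℚ.≤ p → 0ℚ ℚ.≤ q → 0ℚ ℚ.≤ p ℚ.* q
0≤* {p} {q} 0≤p 0≤q = ℚ.nonNegative⁻¹ (p ℚ.* q)
  {{ℚ.nonNeg*nonNeg⇒nonNeg p {{ℚ.nonNegative 0≤p}} q {{ℚ.nonNegative 0≤q}}}}

-- Binomial series modulo ℓ

module _ (ℓ : ℕ) (ℓ-prime : Prime ℓ) where

  open ℓ-adic ℓ ℓ-prime

  private
    module Z = CommutativeRing ℤₗ-commutativeRing
    module S = RawRing seriesRawRing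
    module ZD = RawSemiringDefinitions (RawRing.rawSemiring Z.rawRing)
    module SD = RawSemiringDefinitions S.rawSemiring
    instance
      ℓ≢0 : NonZero ℓ
      ℓ≢0 = prime⇒nonZero ℓ-prime

  euclidℤ : ∀ i j → + ℓ ∣ i ℤ.* j → + ℓ ∣ i ⊎ + ℓ ∣ j
  euclidℤ i j h with euclidsLemma ℤ.∣ i ∣ ℤ.∣ j ∣ ℓ-prime (subst (ℓ ℕ.∣_) (ℤ.abs-* i j) (∣⇒∣ᵤ h))
  ... | inj₁ ℓ∣i = inj₁ (∣ᵤ⇒∣ ℓ∣i)
  ... | inj₂ ℓ∣j = inj₂ (∣ᵤ⇒∣ ℓ∣j)

  ∤1 : ¬ (+ ℓ ∣ 1ℤ)
  ∤1 h = ℕ.<⇒≱ (ℕ.nonTrivial⇒n>1 ℓ {{prime⇒nonTrivial ℓ-prime}}) (ℕ.∣⇒≤ (∣⇒∣ᵤ h))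

  ∣-cancelˡ : ∀ n {c d} → ¬ (+ ℓ ∣ c) → + (ℓ ^ n) ∣ c ℤ.* d → + (ℓ ^ n) ∣ d
  ∣-cancelˡ n {c} {d} ℓ∤c h = ∣ᵤ⇒∣ (cancel-coprime n (ℓ∤c ∘ ∣ᵤ⇒∣)
    (subst (ℓ ^ n ℕ.∣_) (ℤ.abs-* c d) (∣⇒∣ᵤ h)))

  -- By absorption, i C(n, i) = n C(n-1, i-1) is divisible by ℓ^a. If ℓ did not divide C(n, i), then
  -- ℓ^a would divide i, against 0 < i < ℓ^a.
  binomialℤ-middle : ∀ a {n i} → ℓ ^ a ℕ.∣ n → 0 < i → i < ℓ ^ a → + ℓ ∣ binomialℤ (+ n) i
  binomialℤ-middle a {zero} {suc i} _ _ _ = divides 0ℤ (binomialℤ-0-suc i)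
  binomialℤ-middle a {suc n} {suc i} ℓᵃ∣n _ i<ℓᵃ with + ℓ ∣? binomialℤ (+ suc n) (suc i)
  ... | yes h = h
  ... | no ℓ∤B = contradiction (ℕ.∣⇒≤ (∣⇒∣ᵤ (∣-cancelˡ a ℓ∤B
      (subst (+ (ℓ ^ a) ∣_)
        (trans (sym (binomialℤ-absorption (+ n) i)) (ℤ.*-comm (+ suc i) _))
        (∣m⇒∣m*n {m = + suc n} (binomialℤ (+ n) i) (∣ᵤ⇒∣ ℓᵃ∣n))))))
    (ℕ.<⇒≱ i<ℓᵃ)

  -- By Pascal's rule, C(n-1, i) ≡ - C(n-1, i-1) (mod ℓ) for 0 < i < ℓ ^ a if ℓ ^ a ∣ n.
  binomialℤ-pred : ∀ a {n} → ℓ ^ a ℕ.∣ suc n → ∀ i → i < ℓ ^ a → ¬ (+ ℓ ∣ binomialℤ (+ n) i)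
  binomialℤ-pred a {n} ℓᵃ∣n zero    _ h = ∤1 (subst (+ ℓ ∣_) (binomialℤ-zero (+ n)) h)
  binomialℤ-pred a {n} ℓᵃ∣n (suc i) i< h = binomialℤ-pred a ℓᵃ∣n i (ℕ.<-trans (ℕ.n<1+n i) i<)
    (∣m+n∣m⇒∣n (subst (+ ℓ ∣_) (binomialℤ-pascal (+ n) i)
      (binomialℤ-middle a ℓᵃ∣n (s≤s z≤n) i<)) h)

  -- C(uℓ^a, ℓ^a) = u C(uℓ^a - 1, ℓ^a - 1), and ℓ divides neither factor. With `binomialℤ-middle`
  -- this shows that (1+T)ⁿ - 1 has order exactly ℓ^a modulo ℓ for n = uℓ^a.
  binomialℤ-exact : ∀ a u → ¬ (ℓ ℕ.∣ u) → ¬ (+ ℓ ∣ binomialℤ (+ (u * ℓ ^ a)) (ℓ ^ a))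
  binomialℤ-exact a u ℓ∤u h =
    [ ℓ∤u ∘ ∣⇒∣ᵤ
    , binomialℤ-pred a (ℕ.divides u 1+n≡) q (subst (q <_) 1+q≡ (ℕ.n<1+n q)) ]′
    (euclidℤ (+ u) (binomialℤ (+ n) q) (subst (+ ℓ ∣_)
      (trans (cong₂ (λ x y → binomialℤ (+ x) y) (sym 1+n≡) (sym 1+q≡))
             (binomialℤ-quotient u n q (trans 1+n≡ (cong (u *_) (sym 1+q≡))))) h))
    where
    instance
      _ = ℕ.m^n≢0 ℓ a
      _ = ℕ.≢-nonZero (λ u≡0 → ℓ∤u (subst (ℓ ℕ.∣_) (sym u≡0) (ℓ ℕ.∣0)))
      _ = ℕ.m*n≢0 u (ℓ ^ a)
    n = ℕ.pred (u * ℓ ^ a)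
    q = ℕ.pred (ℓ ^ a)
    1+n≡ : suc n ≡ u * ℓ ^ a
    1+n≡ = ℕ.suc-pred (u * ℓ ^ a)
    1+q≡ : suc q ≡ ℓ ^ a
    1+q≡ = ℕ.suc-pred (ℓ ^ a)

  -- Here a is the ℓ-adic valuation of n; the hypothesis excludes n = 0 and forces a < k.
  exactPower : ∀ k n → ¬ (ℓ ^ k ℕ.∣ n) →
               ∃[ a ] ∃[ u ] (a < k × ¬ (ℓ ℕ.∣ u) × n ≡ u * ℓ ^ a)
  exactPower zero    n h = contradiction (ℕ.1∣ n) h
  exactPower (suc k) n h with ℓ ℕ.∣? n
  ... | no ℓ∤n = 0 , n , s≤s z≤n , ℓ∤n , sym (ℕ.*-identityʳ n)
  ... | yes (ℕ.divides q refl) =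
    let a , u , a<k , ℓ∤u , q≡ = exactPower k q
          (λ ℓᵏ∣q → h (subst (ℓ ^ suc k ℕ.∣_) (ℕ.*-comm ℓ q) (ℕ.*-monoʳ-∣ ℓ ℓᵏ∣q)))
    in suc a , u , s≤s a<k , ℓ∤u ,
       trans (cong (_* ℓ) q≡) (trans (ℕ.*-assoc u (ℓ ^ a) ℓ) (cong (u *_) (ℕ.*-comm (ℓ ^ a) ℓ)))

  -- (1+T)ⁿ - 1 has order at most ℓ ^ k in 𝔽_ℓ[[T]], hence dividing by it
  -- loses at most that much precision.
  cancel-[1+T]^n-1 : ∀ k n → ¬ (ℓ ^ k ℕ.∣ n) → ∀ f M →
    (∀ j → j < ℓ ^ k ℕ.+ M → + ℓ ∣ conv (binomialℤ (+ n)) f j ℤ.- f j) →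
    ∀ j → j < M → + ℓ ∣ f j
  cancel-[1+T]^n-1 k n ℓᵏ∤n f M h with exactPower k n ℓᵏ∤n
  -- Strong induction on j: once f vanishes modulo ℓ below j, the coefficient of ((1+T)ⁿ - 1) f at
  -- ℓ^a + j is congruent to C(n, ℓ^a) f(j), and its first factor is prime to ℓ.
  ... | a , u , a<k , ℓ∤u , refl = <-rec _ step
    where
    c = binomialℤ (+ (u * ℓ ^ a))
    -- The constant term 1 of (1+T)ⁿ cancels against the subtracted f. What remains is the
    -- convolution with `c ∘ suc`, whose leading index is ℓ^a - 1.
    e = ℕ.pred (ℓ ^ a)
    1+e≡ : suc e ≡ ℓ ^ a
    1+e≡ = ℕ.suc-pred (ℓ ^ a) {{ℕ.m^n≢0 ℓ a}}

    step : ∀ j → (∀ {i} → i < j → i < M → + ℓ ∣ f i) → j < M → + ℓ ∣ f j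
    step j ih j<M with euclidℤ (c (suc e)) (f j) ℓ∣cf
      where
      n′ = suc e ℕ.+ j
      lem : ∀ x y z → (1ℤ ℤ.* x ℤ.+ y ℤ.- x) ℤ.- (y ℤ.- z) ≡ z
      lem = solve-∀
      ℓ∣cf : + ℓ ∣ c (suc e) ℤ.* f j
      ℓ∣cf = subst (+ ℓ ∣_)
        (trans (cong (λ x → (x ℤ.* f n′ ℤ.+ conv (c ∘ suc) f (e ℕ.+ j) ℤ.- f n′)
                   ℤ.- (conv (c ∘ suc) f (e ℕ.+ j) ℤ.- c (suc e) ℤ.* f j))
                 (binomialℤ-zero (+ (u * ℓ ^ a))))
               (lem (f n′) _ _))
        (∣m∣n⇒∣m-n
          (h n′ (ℕ.+-mono-≤-< (subst (_≤ ℓ ^ k) (sym 1+e≡) (ℕ.^-monoʳ-≤ ℓ (ℕ.<⇒≤ a<k))) j<M))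
          (conv-leading (c ∘ suc) f e j
            (λ i i<e → binomialℤ-middle a (ℕ.divides u refl) (s≤s z≤n)
              (subst (suc i <_) 1+e≡ (s≤s i<e)))
            (λ i i<j → ih i<j (ℕ.<-trans i<j j<M))))
    ... | inj₂ ℓ∣f = ℓ∣f
    ... | inj₁ ℓ∣c = contradiction (subst (λ x → + ℓ ∣ c x) 1+e≡ ℓ∣c) (binomialℤ-exact a u ℓ∤u)

  -- Recovering an exponent up to sign from (1+T)ˣ + (1+T)⁻ˣ

  symmetric : ℤ → ℕ → ℤ
  symmetric x n = binomialℤ x n ℤ.+ binomialℤ (ℤ.- x) n

  -- Dividing by two factors of order at most ℓ ^ k leaves one coefficient.
  precision : ℕ → ℕ
  precision k = ℓ ^ k ℕ.+ (ℓ ^ k ℕ.+ 1)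

  -- With x = y + d,
  -- (1+T)ˣ ((1+T)ˣ + (1+T)⁻ˣ - (1+T)ʸ - (1+T)⁻ʸ) = ((1+T)ˣ⁺ʸ - 1) ((1+T)ᵈ - 1).
  symmetric-injective-≥ : ∀ k y d →
    (∀ j → j < precision k → + ℓ ∣ symmetric (+ (y ℕ.+ d)) j ℤ.- symmetric (+ y) j) →
    (ℓ ^ k ℕ.∣ d) ⊎ (ℓ ^ k ℕ.∣ (y ℕ.+ d) ℕ.+ y)
  symmetric-injective-≥ k y d h with ℓ ^ k ℕ.∣? d | ℓ ^ k ℕ.∣? ((y ℕ.+ d) ℕ.+ y)
  ... | yes p | _     = inj₁ p
  ... | no  _ | yes q = inj₂ q
  -- If neither exponent is divisible by ℓ^k, both factors can be cancelled: `ℓ∣D` removes (1+T)ˢ -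
  -- 1, and the cancellation below removes (1+T)ᵈ - 1 from its product with the series 1, leaving ℓ
  -- ∣ 1.
  ... | no ¬p | no ¬q = contradiction
      (subst (+ ℓ ∣_) (binomialℤ-zero 0ℤ)
        (cancel-[1+T]^n-1 k d ¬p (binomialℤ 0ℤ) 1
          (λ j j< → subst (λ z → + ℓ ∣ z ℤ.- binomialℤ 0ℤ j)
            (sym (trans (vandermonde d 0ℤ j) (cong (λ z → binomialℤ z j) (ℤ.+-identityʳ (+ d)))))
            (ℓ∣D j j<))
          0 (s≤s z≤n)))
      ∤1
    where
    x = y ℕ.+ d
    s = x ℕ.+ y
    X = binomialℤ (+ x)
    D : ℕ → ℤ
    D j = binomialℤ (+ d) j ℤ.- binomialℤ 0ℤ j

    open ≡-Reasoning

    shift : ∀ n z {w} → + n ℤ.+ z ≡ w → ∀ j → conv (binomialℤ (+ n)) (binomialℤ z) j ≡ binomialℤ w j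
    shift n z refl = vandermonde n z

    x-y≡d : + x ℤ.- + y ≡ + d
    x-y≡d = trans (cong (ℤ._- + y) (ℤ.pos-+ y d)) (lem (+ y) (+ d))
      where
      lem : ∀ y d → (y ℤ.+ d) ℤ.- y ≡ d
      lem = solve-∀

    s+d≡x+x : + s ℤ.+ + d ≡ + x ℤ.+ + x
    s+d≡x+x = cong +_ (ℕ.+-assoc x y d)

    product : ∀ j → conv X (λ i → symmetric (+ x) i ℤ.- symmetric (+ y) i) j
                  ≡ conv (binomialℤ (+ s)) D j ℤ.- D j
    product j = begin
      conv X (λ i → symmetric (+ x) i ℤ.- symmetric (+ y) i) j
        ≡⟨ conv-distribˡ-- X (symmetric (+ x)) (symmetric (+ y)) j ⟩
      conv X (symmetric (+ x)) j ℤ.- conv X (symmetric (+ y)) j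
        ≡⟨ cong₂ ℤ._-_
             (conv-distribˡ-+ X (binomialℤ (+ x)) (binomialℤ (ℤ.- + x)) j)
             (conv-distribˡ-+ X (binomialℤ (+ y)) (binomialℤ (ℤ.- + y)) j) ⟩
      (conv X (binomialℤ (+ x)) j ℤ.+ conv X (binomialℤ (ℤ.- + x)) j)
        ℤ.- (conv X (binomialℤ (+ y)) j ℤ.+ conv X (binomialℤ (ℤ.- + y)) j)
        ≡⟨ cong₂ ℤ._-_
             (cong₂ ℤ._+_ (shift x (+ x) (sym s+d≡x+x) j) (shift x (ℤ.- + x) (ℤ.+-inverseʳ (+ x)) j))
             (cong₂ ℤ._+_ (shift x (+ y) refl j) (shift x (ℤ.- + y) x-y≡d j)) ⟩
      (binomialℤ (+ s ℤ.+ + d) j ℤ.+ binomialℤ 0ℤ j)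
        ℤ.- (binomialℤ (+ s) j ℤ.+ binomialℤ (+ d) j)
        ≡⟨ lem (binomialℤ (+ s ℤ.+ + d) j) (binomialℤ 0ℤ j) (binomialℤ (+ s) j) (binomialℤ (+ d) j) ⟩
      (binomialℤ (+ s ℤ.+ + d) j ℤ.- binomialℤ (+ s) j) ℤ.- D j
        ≡⟨ cong (ℤ._- D j) (cong₂ ℤ._-_
             (vandermonde s (+ d) j) (shift s 0ℤ (ℤ.+-identityʳ (+ s)) j)) ⟨
      (conv (binomialℤ (+ s)) (binomialℤ (+ d)) j ℤ.- conv (binomialℤ (+ s)) (binomialℤ 0ℤ) j) ℤ.- D j
        ≡⟨ cong (ℤ._- D j) (conv-distribˡ-- (binomialℤ (+ s)) (binomialℤ (+ d)) (binomialℤ 0ℤ) j) ⟨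
      conv (binomialℤ (+ s)) D j ℤ.- D j ∎
      where
      lem : ∀ p q r s → (p ℤ.+ q) ℤ.- (r ℤ.+ s) ≡ (p ℤ.- r) ℤ.- (s ℤ.- q)
      lem = solve-∀

    ℓ∣D : ∀ j → j < ℓ ^ k ℕ.+ 1 → + ℓ ∣ D j
    ℓ∣D = cancel-[1+T]^n-1 k s ¬q D (ℓ ^ k ℕ.+ 1) λ j j< →
      subst (+ ℓ ∣_) (product j) (conv-∣ X j (λ i i≤j → h i (ℕ.≤-<-trans i≤j j<)))

  -- Exchanging x and y only changes the sign of the difference, which reduces the claim to the
  -- ordered case.
  symmetric-injective : ∀ k x y →
    (∀ j → j < precision k → + ℓ ∣ symmetric (+ x) j ℤ.- symmetric (+ y) j) →
    + (ℓ ^ k) ∣ + x ℤ.- + y ⊎ + (ℓ ^ k) ∣ + x ℤ.+ + y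
  symmetric-injective k x y h with ℕ.≤-total y x
  ... | inj₁ y≤x with symmetric-injective-≥ k y (x ∸ y)
                        (subst (λ z → ∀ j → j < precision k → + ℓ ∣ symmetric (+ z) j ℤ.- symmetric (+ y) j)
                          (sym (ℕ.m+[n∸m]≡n y≤x)) h)
  ...   | inj₁ p = inj₁ (subst (+ (ℓ ^ k) ∣_)
                     (trans (sym (ℤ.⊖-≥ y≤x)) (sym (ℤ.m-n≡m⊖n x y))) (∣ᵤ⇒∣ p))
  ...   | inj₂ p = inj₂ (∣ᵤ⇒∣ (subst (λ z → ℓ ^ k ℕ.∣ z ℕ.+ y) (ℕ.m+[n∸m]≡n y≤x) p))
  symmetric-injective k x y h | inj₂ x≤y with symmetric-injective-≥ k x (y ∸ x)
      (subst (λ z → ∀ j → j < precision k → + ℓ ∣ symmetric (+ z) j ℤ.- symmetric (+ x) j)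
        (sym (ℕ.m+[n∸m]≡n x≤y))
        (λ j j< → subst (+ ℓ ∣_) (lem (symmetric (+ x) j) (symmetric (+ y) j)) (∣m⇒∣-m (h j j<))))
    where
    lem : ∀ a b → ℤ.- (a ℤ.- b) ≡ b ℤ.- a
    lem = solve-∀
  ... | inj₁ p = inj₁ (subst (+ (ℓ ^ k) ∣_)
                   (trans (sym (ℤ.⊖-≤ x≤y)) (sym (ℤ.m-n≡m⊖n x y))) (∣m⇒∣-m (∣ᵤ⇒∣ p)))
  ... | inj₂ p = inj₂ (∣ᵤ⇒∣ (subst (ℓ ^ k ℕ.∣_)
                   (trans (cong (ℕ._+ x) (ℕ.m+[n∸m]≡n x≤y)) (ℕ.+-comm y x)) p))

  -- The characteristic series modulo ℓ

  mod⇒∣ : ∀ {i j} → i ≡ j [modℓ^ 1 ] → + ℓ ∣ i ℤ.- j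
  mod⇒∣ (congruent h) = subst (λ x → + x ∣ _) (ℕ.*-identityʳ ℓ) h

  ∣-resp-mod : ∀ {i j} → i ≡ j [modℓ^ 1 ] → + ℓ ∣ j → + ℓ ∣ i
  ∣-resp-mod {i} {j} h ℓ∣j = subst (+ ℓ ∣_) (lem i j) (∣m∣n⇒∣m+n (mod⇒∣ h) ℓ∣j)
    where
    lem : ∀ i j → (i ℤ.- j) ℤ.+ j ≡ i
    lem = solve-∀

  -- Residues at level 1 live in ℤ/ℓ, so this says that F is zero in 𝔽_ℓ[[T]].
  Vanishes : Series → Set
  Vanishes F = ∀ n → + ℓ ∣ residue (F n) 1

  sum-∣ : ∀ {n} (h : Vector ℤₗ n) → (∀ i → + ℓ ∣ residue (h i) 1) → + ℓ ∣ residue (ZD.sum h) 1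
  sum-∣ {zero}  h d = divides 0ℤ refl
  sum-∣ {suc n} h d = ∣m∣n⇒∣m+n (d zero) (sum-∣ (h ∘ suc) (d ∘ suc))

  *-vanishesˡ : ∀ F G → Vanishes F → Vanishes (F S.* G)
  *-vanishesˡ F G v n = sum-∣ (λ (i : Fin (suc n)) → F (toℕ i) Z.* G (n ∸ toℕ i)) λ i →
    ∣m⇒∣m*n {m = residue (F (toℕ i)) 1} (residue (G (n ∸ toℕ i)) 1) (v (toℕ i))

  const-vanishes : Vanishes (const (ι (+ ℓ)))
  const-vanishes zero    = ∣-refl
  const-vanishes (suc n) = divides 0ℤ refl

  -- A positive μ leaves at least one factor ℓ in f = ℓ^μ g u.
  μ-positive⇒vanishes : ∀ {t} (α : Vector ℤₗ t) → μ-positive α → Vanishes (characteristicSeries α)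
  μ-positive⇒vanishes α (record { μ = suc μ ; g = g ; u = u ; factorization = f≈ } , _) n =
    ∣-resp-mod (residue-≡ (f≈ n) 1)
      (*-vanishesˡ (P^μ S.* g) u (*-vanishesˡ P^μ g
        (*-vanishesˡ (const (ι (+ ℓ))) (const (ι (+ ℓ)) SD.^ μ) const-vanishes)) n)
    where P^μ = const (ι (+ ℓ)) SD.^ suc μ

  -- A coefficient of 2 - (1+T)ᵇ - (1+T)⁻ᵇ, written just as `residue` unfolds, so that
  -- `residue-characteristicSeries` needs only `refl` and `cong`.
  summand : ℤ → ℕ → ℤ
  summand b n =
    (residue (const (ι (+ 2)) n) 1 ℤ.+ ℤ.- binomialℤ b n) ℤ.+ ℤ.- binomialℤ (ℤ.- b) n

  -- Agrees with the characteristic series of c only modulo ℓ.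
  coefficient : ∀ {t} → Vector ℤ t → ℕ → ℤ
  coefficient {zero}  c n = residue (const (ι 0ℤ) n) 1
  coefficient {suc t} c n = summand (c zero) n ℤ.+ coefficient (c ∘ suc) n

  residue-characteristicSeries : ∀ {t} (α : Vector ℤₗ t) n →
    residue (characteristicSeries α n) 1 ≡ coefficient (λ j → residue (α j) (1 ℕ.+ n !)) n
  residue-characteristicSeries {zero}  α n = refl
  residue-characteristicSeries {suc t} α n =
    cong (ℤ._+_ (summand (residue (α zero) (1 ℕ.+ n !)) n)) (residue-characteristicSeries (α ∘ suc) n)

  coefficient-mod : ∀ {t} {c d : Vector ℤ t} n →
    (∀ j → c j ≡ d j [modℓ^ 1 ℕ.+ n ! ]) → coefficient c n ≡ coefficient d n [modℓ^ 1 ]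
  coefficient-mod {zero}  n h = mod-refl 1 refl
  coefficient-mod {suc t} n h = mod-+
    (mod-+ (mod-+ (mod-refl {residue (const (ι (+ 2)) n) 1} 1 refl) (mod-neg (mod-binomial 1 n (h zero))))
           (mod-neg (mod-binomial 1 n (mod-neg (h zero)))))
    (coefficient-mod n (h ∘ suc))

  VanishesTo : ℕ → ∀ {t} → Pred (Vector ℤ t) 0ℓ
  VanishesTo M c = ∀ n → n < M → + ℓ ∣ coefficient c n

  -- Only finitely many coefficients are tested; the resulting decision procedure lets
  -- `firstCoordinate` search for a compatible first coordinate.
  vanishesTo? : ∀ M {t} → Decidable (VanishesTo M {t})
  vanishesTo? M c = Dec.map′ (λ h n → h {n}) (λ h {n} → h n)
    (ℕ.allUpTo? (λ n → + ℓ ∣? coefficient c n) M)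

  -- In the difference of the two series the constant 2 and the contribution of c cancel, and only
  -- the symmetric parts of x and y remain.
  coefficient-∷-injective : ∀ k {t} x y (c : Vector ℤ t) →
    VanishesTo (precision k) (+ x ∷ᶠ c) →
    VanishesTo (precision k) (+ y ∷ᶠ c) →
    + (ℓ ^ k) ∣ + x ℤ.- + y ⊎ + (ℓ ^ k) ∣ + x ℤ.+ + y
  coefficient-∷-injective k x y c hx hy = symmetric-injective k x y λ j j< →
    subst (+ ℓ ∣_)
      (lem (residue (const (ι (+ 2)) j) 1) (coefficient c j)
        (binomialℤ (+ x) j) (binomialℤ (ℤ.- + x) j) (binomialℤ (+ y) j) (binomialℤ (ℤ.- + y) j))
      (∣m∣n⇒∣m-n (hy j j<) (hx j j<))
    where
    lem : ∀ t c x x′ y y′ →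
          (((t ℤ.+ ℤ.- y) ℤ.+ ℤ.- y′) ℤ.+ c) ℤ.- (((t ℤ.+ ℤ.- x) ℤ.+ ℤ.- x′) ℤ.+ c)
          ≡ (x ℤ.+ x′) ℤ.- (y ℤ.+ y′)
    lem = solve-∀

  -- Approximation of ℓ-adic integers by integers

  ∣ₗ-ι : ∀ N (x : ℤₗ) (c : ℤ) → residue x N ≡ c [modℓ^ N ] → ι (+ (ℓ ^ N)) ∣ₗ (x Z.- ι c)
  ∣ₗ-ι N x c h = record { quotient = q ; equality = ≈-intro λ n → mod-trans
      (mod-refl n (sym (eq n)))
      (mod-+ (mod-trans (mod-refl n (cong (residue x) (ℕ.+-comm N n))) (residue-+ x n N))
             (mod-refl n refl)) }
    where
    -- Division by ℓ^N loses N digits, so the n-th residue of the quotient is read off from x at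
    -- level N + n.
    d : ∀ n → + (ℓ ^ N) ∣ residue x (N ℕ.+ n) ℤ.- c
    d n = divides-difference (mod-trans (residue-+ x N n) h)
    q′ : ℕ → ℤ
    q′ n = _∣_.quotient (d n)
    eq : ∀ n → residue x (N ℕ.+ n) ℤ.- c ≡ q′ n ℤ.* + (ℓ ^ N)
    eq n = _∣_.equality (d n)
    lem₁ : ∀ a b c → a ℤ.- b ≡ (a ℤ.- c) ℤ.- (b ℤ.- c)
    lem₁ = solve-∀
    lem₂ : ∀ a b c → a ℤ.* c ℤ.- b ℤ.* c ≡ c ℤ.* (a ℤ.- b)
    lem₂ = solve-∀
    q : ℤₗ
    q = record
      { residue  = q′
      ; coherent = λ n → congruent (*-cancelˡ-∣ (+ (ℓ ^ N)) {{ℕ.m^n≢0 ℓ N}}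
          (subst₂ _∣_
            (trans (cong +_ (ℕ.^-distribˡ-+-* ℓ N n)) (ℤ.pos-* (ℓ ^ N) (ℓ ^ n)))
            (trans (lem₁ (residue x (N ℕ.+ suc n)) (residue x (N ℕ.+ n)) c)
              (trans (cong₂ ℤ._-_ (eq (suc n)) (eq n)) (lem₂ (q′ (suc n)) (q′ n) (+ (ℓ ^ N)))))
            (divides-difference (mod-trans
              (mod-refl (N ℕ.+ n) (cong (residue x) (ℕ.+-suc N n)))
              (coherent x (N ℕ.+ n))))))
      }

  module _ (N : ℕ) where
    private instance
      ℓ^N≢0 : NonZero (ℓ ^ N)
      ℓ^N≢0 = ℕ.m^n≢0 ℓ N

    reduce : ℤ → Fin (ℓ ^ N)
    reduce i = fromℕ< (n%ℕd<d i (ℓ ^ N))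

    reduce-mod : ∀ i → i ≡ + toℕ (reduce i) [modℓ^ N ]
    reduce-mod i = congruent (divides (i /ℕ (ℓ ^ N)) (begin
      i ℤ.- + toℕ (reduce i)                         ≡⟨ cong (λ x → i ℤ.- + x) (Fin.toℕ-fromℕ< _) ⟩
      i ℤ.- r                                        ≡⟨ cong (ℤ._- r) (a≡a%ℕn+[a/ℕn]*n i (ℓ ^ N)) ⟩
      (r ℤ.+ (i /ℕ (ℓ ^ N)) ℤ.* + (ℓ ^ N)) ℤ.- r     ≡⟨ lem r ((i /ℕ (ℓ ^ N)) ℤ.* + (ℓ ^ N)) ⟩
      (i /ℕ (ℓ ^ N)) ℤ.* + (ℓ ^ N)                   ∎))
      where
      open ≡-Reasoning
      r = + (i %ℕ (ℓ ^ N))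
      lem : ∀ r q → (r ℤ.+ q) ℤ.- r ≡ q
      lem = solve-∀

  -- Writing x - c = ℓ^k z, the witness e is z modulo ℓ^j: a class modulo ℓ^k splits into ℓ^j
  -- classes modulo ℓ^(k+j).
  lift-mod : ∀ k j x c → + (ℓ ^ k) ∣ x ℤ.- c →
             ∃[ e ] x ≡ c ℤ.+ + (ℓ ^ k) ℤ.* + toℕ {ℓ ^ j} e [modℓ^ k ℕ.+ j ]
  lift-mod k j x c (divides z x-c≡) = e , congruent (subst₂ _∣_
      (trans (sym (ℤ.pos-* (ℓ ^ k) (ℓ ^ j))) (cong +_ (sym (ℕ.^-distribˡ-+-* ℓ k j))))
      (trans (lem₁ (+ (ℓ ^ k)) z (+ toℕ e)) (trans (cong (ℤ._- + (ℓ ^ k) ℤ.* + toℕ e) (sym x-c≡))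
        (lem₂ x c (+ (ℓ ^ k) ℤ.* + toℕ e))))
      (*-monoʳ-∣ (+ (ℓ ^ k)) (divides-difference (reduce-mod j z))))
    where
    e = reduce j z
    lem₁ : ∀ l z e → l ℤ.* (z ℤ.- e) ≡ z ℤ.* l ℤ.- l ℤ.* e
    lem₁ = solve-∀
    lem₂ : ∀ x c y → x ℤ.- c ℤ.- y ≡ x ℤ.- (c ℤ.+ y)
    lem₂ = solve-∀

  -- Finitely many balls covering the zero set modulo ℓ

  module _ (k j t : ℕ) where

    open Haar ℓ ℓ-prime (suc t)

    private
      -- The first M coefficients fix the first coordinate up to sign modulo ℓ^k. Coordinates are
      -- read modulo ℓ^N, where the j additional digits are meant to make those coefficients
      -- computable modulo ℓ.
      M N : ℕ
      M = precision k
      N = k ℕ.+ j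

    extend : ∀ {m} → Fin (ℓ ^ N) → Vector (Fin (ℓ ^ N)) m → Vector ℤ (suc m)
    extend x c = (+ toℕ x) ∷ᶠ λ i → + toℕ (c i)

    -- 0 if no first coordinate is compatible with c.
    firstCoordinate : Vector (Fin (ℓ ^ N)) t → ℕ
    firstCoordinate c with Fin.any? (λ x → vanishesTo? M (extend x c))
    ... | yes (x , _) = toℕ x
    ... | no  _       = 0

    -- Compatible first coordinates agree up to sign modulo ℓ^k, so the one found by the search
    -- stands for all of them.
    firstCoordinate-unique : ∀ c x → VanishesTo M (extend x c) →
      + (ℓ ^ k) ∣ + toℕ x ℤ.- + firstCoordinate c ⊎ + (ℓ ^ k) ∣ + toℕ x ℤ.+ + firstCoordinate c
    firstCoordinate-unique c x v with Fin.any? (λ x → vanishesTo? M (extend x c))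
    ... | yes (y , w) = coefficient-∷-injective k (toℕ x) (toℕ y) (λ i → + toℕ (c i)) v w
    ... | no  ∄       = contradiction (x , v) ∄

    signed : Fin 2 → ℤ → ℤ
    signed zero    i = i
    signed (suc _) i = ℤ.- i

    tailOf : Fin ((ℓ ^ N) ^ t) → Vector (Fin (ℓ ^ N)) t
    tailOf = finToFun {ℓ ^ N} {t}

    index : Fin ((ℓ ^ N) ^ t) → Fin 2 → Fin (ℓ ^ j) → Fin ((ℓ ^ N) ^ t * (2 * ℓ ^ j))
    index a s e = combine {(ℓ ^ N) ^ t} {2 * ℓ ^ j} a (combine {2} {ℓ ^ j} s e)

    -- The data are the other coordinates modulo ℓ^N, a sign, and the j digits of the first
    -- coordinate that remain free above ℓ^k. All these balls have level N, hence equal volume.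
    candidate : Fin ((ℓ ^ N) ^ t) → Fin 2 → Fin (ℓ ^ j) → Ball
    candidate a s e = record
      { level  = N
      ; centre = ι (signed s (+ firstCoordinate (tailOf a)) ℤ.+ + (ℓ ^ k) ℤ.* + toℕ e)
                 ∷ᶠ λ i → ι (+ toℕ (tailOf a i))
      }

    candidates : Fin ((ℓ ^ N) ^ t * (2 * ℓ ^ j)) → Ball
    candidates i = let a , i′ = remQuot {(ℓ ^ N) ^ t} (2 * ℓ ^ j) i
                       s , e  = remQuot {2} (ℓ ^ j) i′
                   in candidate a s e

    candidates-index : ∀ a s e → candidates (index a s e) ≡ candidate a s e
    candidates-index a s e =
      trans (cong (λ (a , i′) → let s , e = remQuot {2} (ℓ ^ j) i′ in candidate a s e)
                  (Fin.remQuot-combine {(ℓ ^ N) ^ t} {2 * ℓ ^ j} a (combine {2} {ℓ ^ j} s e)))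
            (cong (λ (s , e) → candidate a s e) (Fin.remQuot-combine {2} {ℓ ^ j} s e))

    ∈-candidate : ∀ α (a : Fin ((ℓ ^ N) ^ t)) s x →
      (∀ i → residue (α i) N ≡ extend x (tailOf a) i [modℓ^ N ]) →
      + (ℓ ^ k) ∣ + toℕ x ℤ.- signed s (+ firstCoordinate (tailOf a)) →
      ∃[ e ] α ∈ᵇ candidate a s e
    ∈-candidate α a s x h d =
      let e , x≡ = lift-mod k j (+ toℕ x) (signed s (+ firstCoordinate (tailOf a))) d
      in e , λ where
        zero    → ∣ₗ-ι N (α zero) _ (mod-trans (h zero) x≡)
        (suc i) → ∣ₗ-ι N (α (suc i)) _ (h (suc i))

    ∈-candidates : ∀ α a x →
      (∀ i → residue (α i) N ≡ extend x (tailOf a) i [modℓ^ N ]) →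
      VanishesTo M (extend x (tailOf a)) →
      ∃[ i ] α ∈ᵇ candidates i
    ∈-candidates α a x h v =
      [ member zero
      , member (suc zero) ∘ subst (λ z → + (ℓ ^ k) ∣ + toℕ x ℤ.+ z) (sym (ℤ.neg-involutive y)) ]′
      (firstCoordinate-unique (tailOf a) x v)
      where
      y = + firstCoordinate (tailOf a)
      member : ∀ s → + (ℓ ^ k) ∣ + toℕ x ℤ.- signed s y → ∃[ i ] α ∈ᵇ candidates i
      member s d =
        let e , α∈ = ∈-candidate α a s x h d
        in index a s e , subst (α ∈ᵇ_) (sym (candidates-index a s e)) α∈

    -- Reading b modulo ℓ ^ (1 + n!) determines its n-th binomial coefficient modulo ℓ.
    candidates-cover : precision k ! < j → ∀ α →
      Vanishes (characteristicSeries α) → ∃[ i ] α ∈ᵇ candidates i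
    candidates-cover M!<j α v = ∈-candidates α a x α≡ vanishing
      where
      tail : Vector (Fin (ℓ ^ N)) t
      tail i = reduce N (residue (α (suc i)) N)
      a = funToFin {t} {ℓ ^ N} tail
      x = reduce N (residue (α zero) N)

      α≡ : ∀ i → residue (α i) N ≡ extend x (tailOf a) i [modℓ^ N ]
      α≡ zero    = reduce-mod N (residue (α zero) N)
      α≡ (suc i) = mod-trans (reduce-mod N (residue (α (suc i)) N))
        (mod-refl N (cong (λ z → + toℕ z) (sym (Fin.finToFun-funToFin {t} {ℓ ^ N} tail i))))

      1+n!≤j : ∀ {n} → n < M → 1 ℕ.+ n ! ≤ j
      1+n!≤j n< = ℕ.≤-<-trans (ℕ.∣⇒≤ {{M ℕ.!≢0}} (ℕ.m≤n⇒m!∣n! (ℕ.<⇒≤ n<))) M!<j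

      α≡′ : ∀ {n} → n ≤ j → ∀ i → residue (α i) n ≡ extend x (tailOf a) i [modℓ^ n ]
      α≡′ {n} n≤j i = mod-trans
        (mod-sym (subst (λ z → residue (α i) z ≡ residue (α i) n [modℓ^ n ])
                        (ℕ.m+[n∸m]≡n n≤N) (residue-+ (α i) n (N ∸ n))))
        (mod-weaken n≤N (α≡ i))
        where
        n≤N : n ≤ N
        n≤N = ℕ.≤-trans n≤j (ℕ.m≤n+m j k)

      vanishing : VanishesTo M (extend x (tailOf a))
      vanishing n n< = ∣-resp-mod
        (mod-sym (coefficient-mod n (α≡′ (1+n!≤j n<))))
        (subst (+ ℓ ∣_) (residue-characteristicSeries α n) (v n))

  -- The zero set modulo ℓ has measure zero

  module _ (t : ℕ) where

    open Haar ℓ ℓ-prime t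

    finiteCover : ∀ (S : Pred (Vector ℤₗ t) 0ℓ) {K} (B : Fin K → Ball) →
                  (∀ α → S α → ∃[ i ] α ∈ᵇ B i) → Cover S
    finiteCover S {K} B h = record
      { ball   = nth K B
      ; covers = λ {α} α∈S → let i , α∈Bᵢ = h α α∈S in
          toℕ i , subst (Maybe.Any (α ∈ᵇ_)) (sym (nth-toℕ B i)) (Maybe.just α∈Bᵢ)
      }

  module _ (t : ℕ) where

    open Haar ℓ ℓ-prime (suc t)

    module _ (S : Pred (Vector ℤₗ (suc t)) 0ℓ) (S⇒vanishes : ∀ α → S α → Vanishes (characteristicSeries α))
             (p : ℚ) (k j : ℕ) where
      private
        N K : ℕ
        N = k ℕ.+ j
        K = (ℓ ^ N) ^ t * (2 * ℓ ^ j)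
        instance
          D≢0 : NonZero (ℓ ^ (N * suc t))
          D≢0 = ℕ.m^n≢0 ℓ (N * suc t) {{prime⇒nonZero ℓ-prime}}

      vanishingCover : precision k ! < j → Cover S
      vanishingCover M!<j = finiteCover (suc t) S (candidates k j t)
        λ α α∈S → candidates-cover k j t M!<j α (S⇒vanishes α α∈S)

      -- K balls of volume ℓ^(-N(t+1)) have total volume 2ℓ^(-k), since N = k + j. The inequality is
      -- 2ℓ^(-k) ≤ 1 / `ℚ.↧ₙ p` with denominators cleared, as `/-≤` requires.
      candidates-count : 2 * ℚ.↧ₙ p ≤ ℓ ^ k → K * ℚ.↧ₙ p ≤ ℓ ^ (N * suc t)
      candidates-count 2d≤ = begin
        (ℓ ^ N) ^ t * (2 * ℓ ^ j) * ℚ.↧ₙ p      ≡⟨ lem ((ℓ ^ N) ^ t) (ℓ ^ j) (ℚ.↧ₙ p) ⟩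
        2 * ℚ.↧ₙ p * ℓ ^ j * (ℓ ^ N) ^ t        ≤⟨ ℕ.*-monoˡ-≤ ((ℓ ^ N) ^ t) (ℕ.*-monoˡ-≤ (ℓ ^ j) 2d≤) ⟩
        ℓ ^ k * ℓ ^ j * (ℓ ^ N) ^ t             ≡⟨ cong (_* (ℓ ^ N) ^ t) (ℕ.^-distribˡ-+-* ℓ k j) ⟨
        (ℓ ^ N) ^ suc t                         ≡⟨ ℕ.^-*-assoc ℓ N (suc t) ⟩
        ℓ ^ (N * suc t)                         ∎
        where
        open ℕ.≤-Reasoning
        lem : ∀ a b p → a * (2 * b) * p ≡ 2 * p * b * a
        lem = ℕ.solve-∀

      vanishingCover-volume : .{{_ : Positive p}} → 2 * ℚ.↧ₙ p ≤ ℓ ^ k → ∀ M!<j n →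
        totalVolumeUpTo (vanishingCover M!<j) n ℚ.≤ p
      vanishingCover-volume 2d≤ M!<j n = ℚ.≤-trans
        (∑-nth-≤ (ℓ ^ (N * suc t)) volume K (candidates k j t) (λ _ → refl) n id (λ _ → refl))
        (/-≤ K (ℓ ^ (N * suc t)) p (candidates-count 2d≤))

    SmallCover : Pred (Vector ℤₗ (suc t)) 0ℓ → ℚ → Set
    SmallCover S p = Σ[ c ∈ Cover S ] (∀ n → totalVolumeUpTo c n ℚ.≤ p)

    smallCover : ∀ S → (∀ α → S α → Vanishes (characteristicSeries α)) →
                 ∀ p .{{_ : Positive p}} k j → 2 * ℚ.↧ₙ p ≤ ℓ ^ k →
                 precision k ! < j → SmallCover S p
    smallCover S S⇒vanishes p k j 2d≤ M!<j =
      vanishingCover S S⇒vanishes p k j M!<j , vanishingCover-volume S S⇒vanishes p k j 2d≤ M!<j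

    τ-vanishes : ∀ S → (∀ α → S α → Vanishes (characteristicSeries α)) → τ S ≤ᵘ 0ℚ
    τ-vanishes S S⇒vanishes r 0<r =
      let p , 0<p , p<r = ℚ.<-dense 0<r
          -- As k < ℓ^k, this k already satisfies 2 `ℚ.↧ₙ p` ≤ ℓ^k. The successor of j is passed on
          -- below because the factorial must be strictly smaller than the number of extra digits.
          k = 2 * ℚ.↧ₙ p
          j = precision k !
      in p , p<r , smallCover S S⇒vanishes p {{ℚ.positive 0<p}} k (suc j)
           (ℕ.<⇒≤ (n<m^n ℓ k (ℕ.nonTrivial⇒n>1 ℓ {{prime⇒nonTrivial ℓ-prime}})))
           (ℕ.n<1+n j)

-- Comparison of measure zero with the nonnegative combinatorial sum

theorem4p6 : (ℓ : ℕ) (ℓ-prime : Prime ℓ) → ℓ ≢ 2 →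
    (t : ℕ) .{{_ : NonZero t}} → 2 ≤ t →
    Haar.Prob[μ>0] ℓ ℓ-prime t ≤ᵘ
    (∑[ i ∈ oneTo ((t / ℓ) {{prime⇒nonZero ℓ-prime}}) ]
    ((+ (2 ^ (i * ℓ) * (t C (i * ℓ))) ℚ./ 1) ℚ.*
    (∑[ a ∈ tuplesOfSum ((ℓ ∸ 1) / 2) i ]
    (+ ((i * ℓ) !) ℚ./ ((ℓ ^ t ∸ 1) * ∏! ℓ a)) {{denominator≢0 ℓ ℓ-prime t a}})))
theorem4p6 ℓ ℓ-prime _ (suc t) _ = ≤ᵘ-trans {Haar.Prob[μ>0] ℓ ℓ-prime (suc t)}
  (÷ᵘ-≤0 {Haar.τ ℓ ℓ-prime (suc t) P} (Haar.admissibleVolume ℓ ℓ-prime (suc t))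
    {{Haar.admissibleVolume-positive ℓ ℓ-prime (suc t)}}
    (τ-vanishes ℓ ℓ-prime t P λ α (_ , μ>0) → μ-positive⇒vanishes ℓ ℓ-prime α μ>0))
  (0≤∑ (oneTo ((suc t / ℓ) {{prime⇒nonZero ℓ-prime}})) λ i →
    0≤* (0≤/ (2 ^ (i * ℓ) * (suc t C (i * ℓ))) 1)
        (0≤∑ (tuplesOfSum ((ℓ ∸ 1) / 2) i) λ a →
          0≤/ ((i * ℓ) !) ((ℓ ^ suc t ∸ 1) * ∏! ℓ a) {{denominator≢0 ℓ ℓ-prime (suc t) a}}))
  where
  open ℓ-adic ℓ ℓ-prime
  P : Pred (Vector ℤₗ (suc t)) 0ℓ
  P α = Admissible α × μ-positive α
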